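{- Let $\delta$ be a diagram of size $n$, let $\lambda\vdash n$, and let $\mathcal G=(V,\sigma,E)$ be a connected component of the Assaf graph $\mathcal H_\delta$ which is a dual equivalence graph and satisfies $\mathcal G\cong\mathcal G_\lambda$. Then exactly one vertex of $V$ lies in $\mathrm{SYam}_\delta(\lambda)$, and $V\cap\mathrm{SYam}_\delta(\mu)=\emptyset$ for every partition $\mu\neq\lambda$.
   Context: Diagrams, row reading order, fillings, $T_\delta(w)$: a diagram is a finite $\delta\subset\mathbb Z\times\mathbb Z$ of cells $(x,y)$; cells are ordered in row reading order (rows top to bottom, each left to right) and numbered $1,\dots,|\delta|$; $T_\delta(w)$ is the filling of $\delta$ whose row reading word is $w$. Pistol starting at $c=(x,y)\in\delta$: the cells $(x',y)\in\delta$ with $x'\ge x$ together with the cells $(x',y-1)\in\delta$ with $x'\le x$. A set of indices (positions) is $\delta$-pistoled if the corresponding cells lie in a common pistol. Yamanouchi words: $\mathrm{Yam}(\lambda)$ is the set of words in which $i$ occurs $\lambda_i$ times and, read right to left, there are never more $i+1$'s than $i$'s so far. Such a $w$ of length $|\delta|$ jams $\delta$ if for some $i,j$ the positions of the $j$-th from last $i$ and the $(j+1)$-th from last $i+1$ are $\delta$-pistoled; $\mathrm{Yam}_\delta(\lambda)$ is the set of non-jamming ones. The standardization $\mathrm{st}(w)$ of a word of length $n$ replaces its $1$'s from left to right by $1,2,\dots,k$, then its $2$'s from left to right by $k+1,\dots$, etc. $\mathrm{SYam}_\delta(\lambda)=\{\mathrm{st}(w):w\in\mathrm{Yam}_\delta(\lambda)\}$.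 Signature: for $\pi\in S_n$, $\sigma(\pi)\in\{\pm1\}^{n-1}$ with $\sigma_i=+1$ iff $i$ precedes $i+1$ in $\pi$. Elementary dual equivalence $d_i$ ($1<i<n$) on $S_n$: $d_i(\dots i\dots i{ - }1\dots i{+}1\dots)=(\dots i{+}1\dots i{ - }1\dots i\dots)$, $d_i(\dots i{ - }1\dots i{+}1\dots i\dots)=(\dots i\dots i{+}1\dots i{ - }1\dots)$, identity if $i$ lies between $i-1$ and $i+1$. $\tilde d_i$: $\tilde d_i(\dots i\dots i{ - }1\dots i{+}1\dots)=(\dots i{ - }1\dots i{+}1\dots i\dots)$, $\tilde d_i(\dots i\dots i{+}1\dots i{ - }1\dots)=(\dots i{+}1\dots i{ - }1\dots i\dots)$, identity if $i$ lies between $i-1$ and $i+1$. For $|\delta|=n$, $D_i^\delta(\pi)=\tilde d_i(\pi)$ if the positions of $i-1,i,i+1$ in $\pi$ are $\delta$-pistoled, and $D_i^\delta(\pi)=d_i(\pi)$ otherwise. The Assaf graph $\mathcal H_\delta$ is the signed colored graph with vertex set $S_n$, signature $\sigma$, and for $2\le i\le n-1$ edge set $E_i=\{\{\pi,D_i^\delta(\pi)\}:D_i^\delta(\pi)\ne\pi\}$. A signed colored graph $(V,\sigma,E)$ has finite vertex set $V$, a signature map $\sigma:V\to\{\pm1\}^{n-1}$, and sets $E_i$ ($2\le i\le n-1$) of unordered pairs of distinct vertices (edges of color $i$). An isomorphism is a bijection on vertices which, with its inverse, preserves signatures and colored edges. For an integer interval $I$, the restriction $\mathcal G|_I$ has the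 same vertices, $\sigma'(v)_i=\sigma(v)_{\min I+i-1}$ for $1\le i\le|I|-1$ (when defined), and $E'_i=E_{\min I+i-1}$ for $2\le i\le|I|-1$ (when defined). For $\lambda\vdash n$ drawn in French notation (row $y\ge0$ has $\lambda_{y+1}$ left-justified cells), $\mathrm{SYT}(\lambda)$ is the set of standard fillings increasing along rows and up columns; $d_i$ acts on $T\in\mathrm{SYT}(\lambda)$ via its row reading word (giving again an element of $\mathrm{SYT}(\lambda)$). The standard dual equivalence graph $\mathcal G_\lambda$ has vertex set $\mathrm{SYT}(\lambda)$, signature $\sigma(\mathrm{rw}(T))$, and $E_i=\{\{T,d_i(T)\}:d_i(T)\ne T\}$. A signed colored graph is a dual equivalence graph if (Locally Standard) for every integer interval $I$ with $|I|=6$ each component of $\mathcal G|_I$ is isomorphic to some $\mathcal G_\lambda$, and (Commuting) whenever $\{v,w\}\in E_i$, $\{w,x\}\in E_j$ with $|i-j|>2$ there is $y$ with $\{v,y\}\in E_j$, $\{x,y\}\in E_i$. -}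

module Defs where

open import Data.Bool using (Bool; true; false; if_then_else_; _∧_; _∨_)
open import Data.Nat using (ℕ; zero; suc; _+_; _∸_; _≤_; _<_; _≡ᵇ_; _<ᵇ_)
open import Data.Integer as ℤ using (ℤ)
open import Data.Product using (Σ; ∃; _×_; _,_)
open import Data.Sum using (_⊎_)
open import Data.List using (List; []; _∷_; _++_; length; map; upTo; concat; reverse; _∷ʳ_)
open import Data.Nat.ListAction using (sum)
open import Data.List.Membership.Propositional using (_∈_)
open import Data.List.Relation.Unary.All using (All)
open import Data.List.Relation.Unary.Linked using (Linked)
open import Data.List.Relation.Binary.Permutation.Propositional using (_↭_)
open import Relation.Binary.PropositionalEquality using (_≡_; _≢_)
open import Relation.Binary.Construct.Closure.ReflexiveTransitive using (Star)
open import Relation.Nullary using (¬_)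
open import Function.Bundles using (_⇔_)

At : {A : Set} → List A → ℕ → A → Set
At {A} xs p x = Σ (List A) λ pre → Σ (List A) λ suf →
  (xs ≡ pre ++ x ∷ suf) × (suc (length pre) ≡ p)

cnt : ℕ → List ℕ → ℕ
cnt a [] = 0
cnt a (x ∷ xs) = if x ≡ᵇ a then suc (cnt a xs) else cnt a xs

cntLt : ℕ → List ℕ → ℕ
cntLt a [] = 0
cntLt a (x ∷ xs) = if x <ᵇ a then suc (cntLt a xs) else cntLt a xs

-- 0-indexed position of the first occurrence of a (length if absent)
pos : ℕ → List ℕ → ℕ
pos a [] = 0
pos a (x ∷ xs) = if x ≡ᵇ a then 0 else suc (pos a xs)

range1 : ℕ → List ℕ
range1 n = map suc (upTo n)

IsPerm : ℕ → List ℕ → Set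
IsPerm n w = w ↭ range1 n

Cell : Set
Cell = ℤ × ℤ

-- row reading order: rows top to bottom, each row left to right
_≺_ : Cell → Cell → Set
(x , y) ≺ (x' , y') = (y' ℤ.< y) ⊎ ((y ≡ y') × (x ℤ.< x'))

-- A diagram (finite subset of ℤ × ℤ) is represented by the list of its
-- cells listed in row reading order (strictly increasing for ≺);
-- the cell numbered p is the p-th entry of this list.
Diagram : List Cell → Set
Diagram δ = Linked _≺_ δ

-- d lies in the pistol starting at c (the membership d ∈ δ is checked separately)
InPistol : Cell → Cell → Set
InPistol (x , y) (x' , y') =
  ((y' ≡ y) × (x ℤ.≤ x')) ⊎ ((y' ≡ y ℤ.- ℤ.1ℤ) × (x' ℤ.≤ x))

Pistoled : List Cell → List ℕ → Set
Pistoled δ ps = Σ Cell λ c → (c ∈ δ) ×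
  All (λ p → Σ Cell λ d → At δ p d × InPistol c d) ps

IsPartition : List ℕ → Set
IsPartition μ = All (1 ≤_) μ × Linked (λ a b → b ≤ a) μ

-- μ_i (1-indexed), 0 beyond the length
part : List ℕ → ℕ → ℕ
part [] i = 0
part (m ∷ μ) zero = 0
part (m ∷ μ) (suc zero) = m
part (m ∷ μ) (suc (suc i)) = part μ (suc i)

Yam : List ℕ → List ℕ → Set
Yam μ w =
  All (1 ≤_) w ×
  (∀ i → 1 ≤ i → cnt i w ≡ part μ i) ×
  (∀ pre suf → w ≡ pre ++ suf → ∀ i → 1 ≤ i → cnt (suc i) suf ≤ cnt i suf)

JthFromLast : List ℕ → ℕ → ℕ → ℕ → Set
JthFromLast w a j p = Σ (List ℕ) λ pre → Σ (List ℕ) λ suf →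
  (w ≡ pre ++ a ∷ suf) × (suc (length pre) ≡ p) × (suc (cnt a suf) ≡ j)

Jams : List Cell → List ℕ → Set
Jams δ w = Σ ℕ λ i → Σ ℕ λ j → Σ ℕ λ p → Σ ℕ λ q →
  (1 ≤ i) × (1 ≤ j) × JthFromLast w i j p × JthFromLast w (suc i) (suc j) q ×
  Pistoled δ (p ∷ q ∷ [])

YamD : List Cell → List ℕ → List ℕ → Set
YamD δ μ w = Yam μ w × (length w ≡ length δ) × ¬ Jams δ w

st : List ℕ → List ℕ
st w = go [] w
  where
  go : List ℕ → List ℕ → List ℕ
  go pre [] = []
  go pre (a ∷ rest) = suc (cntLt a w + cnt a pre) ∷ go (pre ∷ʳ a) rest

SYam : List Cell → List ℕ → List ℕ → Set
SYam δ μ π = Σ (List ℕ) λ w → YamD δ μ w × (st w ≡ π)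

-- σ(π)_i = true (+1) iff i precedes i+1 in π
sigW : List ℕ → ℕ → Bool
sigW π i = pos i π <ᵇ pos (suc i) π

btw : ℕ → ℕ → ℕ → Bool
btw x y z = ((x <ᵇ y) ∧ (y <ᵇ z)) ∨ ((z <ᵇ y) ∧ (y <ᵇ x))

swapV : ℕ → ℕ → ℕ → ℕ
swapV x y v = if v ≡ᵇ x then y else if v ≡ᵇ y then x else v

cyc3 : ℕ → ℕ → ℕ → ℕ → ℕ
cyc3 x y z v = if v ≡ᵇ x then y else if v ≡ᵇ y then z else if v ≡ᵇ z then x else v

d : ℕ → List ℕ → List ℕ
d i w =
  let a = pos (i ∸ 1) w ; b = pos i w ; c = pos (suc i) w in
  if btw a b c then w
  else if btw b a c then map (swapV i (suc i)) w
  else map (swapV i (i ∸ 1)) w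

dt : ℕ → List ℕ → List ℕ
dt i w =
  let a = pos (i ∸ 1) w ; b = pos i w ; c = pos (suc i) w
      lo = if a <ᵇ c then i ∸ 1 else suc i
      hi = if a <ᵇ c then suc i else i ∸ 1
  in
  if btw a b c then w
  else if ((b <ᵇ a) ∧ (b <ᵇ c)) then map (cyc3 i lo hi) w  -- (i,lo,hi) ↦ (lo,hi,i)
  else map (cyc3 lo i hi) w                           -- (lo,hi,i) ↦ (i,lo,hi)

Pistoled3 : List Cell → ℕ → List ℕ → Set
Pistoled3 δ i π = Σ ℕ λ p → Σ ℕ λ q → Σ ℕ λ r →
  At π p (i ∸ 1) × At π q i × At π r (suc i) × Pistoled δ (p ∷ q ∷ r ∷ [])

DRel : List Cell → ℕ → List ℕ → List ℕ → Set
DRel δ i π π' = (Pistoled3 δ i π × (π' ≡ dt i π)) ⊎ (¬ Pistoled3 δ i π × (π' ≡ d i π))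

-- Signed colored graphs
-- A graph is given by a vertex type with a vertex predicate (the actual
-- vertex set), a signature map (indices i = 1..m-1 are used, where m is
-- passed separately) and edge relations E i (colors 2..m-1 are used).

record SCG : Set₁ where
  field
    V   : Set
    sig : V → ℕ → Bool
    E   : ℕ → V → V → Set
open SCG public

Step : (G : SCG) → (V G → Set) → ℕ → V G → V G → Set
Step G P m x y = P x × P y × Σ ℕ λ i → (2 ≤ i) × (i < m) × E G i x y

Comp : (G : SCG) → (V G → Set) → ℕ → V G → V G → Set
Comp G P m v0 v = P v × Star (Step G P m) v0 v

record Iso (m : ℕ) (G : SCG) (C : V G → Set) (H : SCG) (D : V H → Set) : Set where
  field
    g        : V H → V G
    into     : ∀ w → D w → C (g w)
    inj      : ∀ w w' → D w → D w' → g w ≡ g w' → w ≡ w'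
    surj     : ∀ v → C v → Σ (V H) λ w → D w × (g w ≡ v)
    sigPres  : ∀ w → D w → ∀ i → 1 ≤ i → i < m → sig G (g w) i ≡ sig H w i
    edgePres : ∀ w w' → D w → D w' → ∀ i → 2 ≤ i → i < m →
               (E G i (g w) (g w') ⇔ E H i w w')

restrict : SCG → ℕ → SCG
restrict G l = record
  { V = V G
  ; sig = λ v i → sig G v (l + i ∸ 1)
  ; E = λ i → E G (l + i ∸ 1)
  }

-- tableaux are lists of rows, bottom row (y = 0) first (French notation)
rw : List (List ℕ) → List ℕ
rw t = concat (reverse t)

ColUp : List ℕ → List ℕ → Set
ColUp r r' = ∀ k x y → At r' k y → At r k x → x < y

SYT : List ℕ → List (List ℕ) → Set
SYT μ t =
  (map length t ≡ μ) × (concat t ↭ range1 (sum μ)) ×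
  All (Linked _<_) t × Linked ColUp t

-- the graph whose restriction to SYT μ is 𝒢_μ
StdGraph : SCG
StdGraph = record
  { V = List (List ℕ)
  ; sig = λ t → sigW (rw t)
  ; E = λ i t t' → ((rw t' ≡ d i (rw t)) × (rw t' ≢ rw t))
                 ⊎ ((rw t ≡ d i (rw t')) × (rw t ≢ rw t'))
  }

-- The Assaf graph H_δ (vertex set: IsPerm |δ|)

Assaf : List Cell → SCG
Assaf δ = record
  { V = List ℕ
  ; sig = sigW
  ; E = λ i π π' → (DRel δ i π π' × (π' ≢ π)) ⊎ (DRel δ i π' π × (π ≢ π'))
  }

-- the nonempty intervals [l,u] = I ∩ [1,m] for integer intervals I with |I| = 6
GoodInterval : ℕ → ℕ → ℕ → Set
GoodInterval m l u = (1 ≤ l) × (l ≤ u) × (u ≤ m) ×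
  ((suc (u ∸ l) ≡ 6) ⊎ (((l ≡ 1) ⊎ (u ≡ m)) × (suc (u ∸ l) ≤ 6)))

Far : ℕ → ℕ → Set
Far i j = (suc (suc i) < j) ⊎ (suc (suc j) < i)

record IsDEG (m : ℕ) (G : SCG) (C : V G → Set) : Set where
  field
    locallyStandard : ∀ l u → GoodInterval m l u → ∀ v0 → C v0 →
      Σ (List ℕ) λ μ → IsPartition μ × (sum μ ≡ suc (u ∸ l)) ×
        Iso (suc (u ∸ l)) (restrict G l) (Comp (restrict G l) C (suc (u ∸ l)) v0)
            StdGraph (SYT μ)
    commuting : ∀ v w x i j → C v → C w → C x →
      2 ≤ i → i < m → 2 ≤ j → j < m → Far i j →
      E G i v w → E G j w x →
      Σ (V G) λ y → C y × E G j v y × E G i x y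

{-# OPTIONS --safe #-}
module Submission where

-- Write a filling through the positions p v of its values v. The cells of a pistol form an
-- interval in row reading order, so D_i only depends on the relative order of three positions
-- and on whether the extreme two are pistoled. The isomorphism 𝒢_λ ≅ 𝒢 is then a bisimulation
-- between the moves d_i on tableaux (no two positions pistoled) and the moves D_i on V, and the
-- two sides can be treated symmetrically. Being a non-jamming standardized Yamanouchi word is a
-- condition on consecutive rows of equal length k, with positions a 0 < a 1 < … and
-- b 0 < b 1 < …, namely b j < a j, and b j, a (j + 1) not pistoled. This condition passes
-- through every bisimulation, by induction on k: moving the value of b 0 down step by step until
-- it sits just above that of a 0 isolates a row pair of length k - 1 (and so does moving the
-- value of a (k - 1) up), and the moves met on the other side are forced to be the same. Among
-- tableaux of shape λ the condition for μ holds only for the superstandard one, and for μ = λ.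

-- On the side where the condition is to be proved, induction first gives a weaker one: `b j` is
-- compared with `a (j + 1)` and `a (j + 2)`, by dropping the first entry of row `a` and the last
-- entry of row `b`. This forces every sinking move except the last, which acts on the values at
-- `a 0`, `a 1`, `b 0`. The outcome of that move is open, but induction applies again to the rows it
-- leaves, and only one obstruction survives: `b 0` and `a 1` are pistoled while the later entries
-- are in order. For k at least 3, raising the last value of `a` isolates shorter rows that still
-- contain this pair, so induction excludes it. For k = 2 this fails, because rows of length 1 carry
-- no jam condition. There two moves of neighbouring colors have the same result on the known side
-- and would have different results on the other, although the two sides correspond one to one.

open import Defs
open import Data.Bool using (true; false; if_then_else_)
open import Data.Bool.Properties using (T-≡)
open import Data.Empty using (⊥; ⊥-elim)
open import Data.Integer as ℤ using ()
import Data.Integer.Properties as ℤ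
open import Data.List using (List; []; _∷_; _++_; length; map; concat; reverse; applyUpTo; upTo; _∷ʳ_; [_])
open import Data.List.Membership.Propositional using (_∈_; _∉_; find; lose)
open import Data.List.Membership.Propositional.Properties
  using (∈-map⁺; ∈-map⁻; ∈-upTo⁺; ∈-upTo⁻; ∈-++⁺ˡ; ∈-++⁺ʳ; ∈-++⁻)
open import Data.List.Membership.Propositional.Properties.WithK using (unique∧set⇒bag)
open import Data.List.Properties
  using (++-assoc; ++-identityʳ; ∷-injectiveˡ; ∷-injectiveʳ; concat-++; length-map; length-upTo;
         map-++; map-applyUpTo; reverse-injective; reverse-map; unfold-reverse)
open import Data.List.Relation.Binary.BagAndSetEquality using (∼bag⇒↭)
open import Data.List.Relation.Binary.Permutation.Propositional as ↭
  using (_↭_; ↭-refl; ↭-reflexive; ↭-sym; ↭-trans; ↭⇒↭ₛ)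
open import Data.List.Relation.Binary.Permutation.Propositional.Properties
  using (∈-resp-↭; map⁺; ↭-length; ↭-reverse; ++⁺ˡ; ++⁺ʳ; ++-comm)
import Data.List.Relation.Binary.Permutation.Setoid.Properties as ↭ₛ
open import Data.List.Relation.Unary.All as All using (All; []; _∷_)
open import Data.List.Relation.Unary.AllPairs using (AllPairs; []; _∷_)
open import Data.List.Relation.Unary.Any using (here; there; any?)
open import Data.List.Relation.Unary.Linked using (Linked; []; [-]; _∷_)
open import Data.List.Relation.Unary.Linked.Properties using (Linked⇒AllPairs)
open import Data.List.Relation.Unary.Unique.Propositional using (Unique)
import Data.List.Relation.Unary.Unique.Propositional.Properties as Unique
open import Data.Nat using (ℕ; zero; suc; _+_; _*_; _∸_; _≤_; _<_; z≤n; s≤s; s<s; _≡ᵇ_; _<ᵇ_)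
open import Data.Nat.ListAction using (sum)
open import Data.Nat.Properties
open import Data.List.Membership.DecPropositional _≟_ using (_∈?_)
open import Data.Product using (Σ; ∃; _×_; _,_; proj₁; proj₂)
open import Data.Sum using (_⊎_; inj₁; inj₂)
open import Function using (_∘_)
open import Function.Bundles using (Equivalence; mk⇔)
open import Relation.Binary.Construct.Closure.ReflexiveTransitive using (ε; _◅_; _◅◅_)
open import Relation.Binary.Definitions using (tri<; tri≈; tri>)
open import Relation.Binary.PropositionalEquality hiding ([_])
open import Relation.Nullary using (¬_; Dec; yes; no)
open import Relation.Nullary.Decidable using (map′; _×-dec_; _⊎-dec_)

-- Positions of values in words and permutations

≡ᵇ-true : ∀ {m n} → m ≡ n → (m ≡ᵇ n) ≡ true
≡ᵇ-true {m} {n} eq = Equivalence.to T-≡ (≡⇒≡ᵇ m n eq)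

≡ᵇ-false : ∀ {m n} → m ≢ n → (m ≡ᵇ n) ≡ false
≡ᵇ-false {m} {n} ne with m ≡ᵇ n in eq
... | false = refl
... | true = ⊥-elim (ne (≡ᵇ⇒≡ m n (Equivalence.from T-≡ eq)))

<ᵇ-true : ∀ {m n} → m < n → (m <ᵇ n) ≡ true
<ᵇ-true lt = Equivalence.to T-≡ (<⇒<ᵇ lt)

<ᵇ-false : ∀ {m n} → n ≤ m → (m <ᵇ n) ≡ false
<ᵇ-false {m} {n} le with m <ᵇ n in eq
... | false = refl
... | true = ⊥-elim (<⇒≱ (<ᵇ⇒< m n (Equivalence.from T-≡ eq)) le)

<ᵇ-true⁻ : ∀ {m n} → (m <ᵇ n) ≡ true → m < n
<ᵇ-true⁻ {m} {n} eq = <ᵇ⇒< m n (Equivalence.from T-≡ eq)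

-- Nth x xs k: the entry of xs at the 0-indexed position k is x (At is 1-indexed).
data Nth {A : Set} (x : A) : List A → ℕ → Set where
  here  : ∀ {xs} → Nth x (x ∷ xs) 0
  there : ∀ {y xs k} → Nth x xs k → Nth x (y ∷ xs) (suc k)

module _ {A : Set} where

  nth-++ : ∀ (pre : List A) {x suf} → Nth x (pre ++ x ∷ suf) (length pre)
  nth-++ [] = here
  nth-++ (_ ∷ pre) = there (nth-++ pre)

  nth-++ˡ : ∀ {x xs k} ys → Nth {A} x xs k → Nth x (xs ++ ys) k
  nth-++ˡ ys here = here
  nth-++ˡ ys (there i) = there (nth-++ˡ ys i)

  nth-++ʳ : ∀ {x ys k} xs → Nth {A} x ys k → Nth x (xs ++ ys) (length xs + k)
  nth-++ʳ [] i = i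
  nth-++ʳ (_ ∷ xs) i = there (nth-++ʳ xs i)

  nth-split : ∀ {x xs k} → Nth {A} x xs k →
    Σ (List A) λ pre → Σ (List A) λ suf → (xs ≡ pre ++ x ∷ suf) × (length pre ≡ k)
  nth-split {xs = _ ∷ xs} here = [] , xs , refl , refl
  nth-split {xs = y ∷ _} (there i) with nth-split i
  ... | pre , suf , refl , refl = y ∷ pre , suf , refl , refl

  nth⇒At : ∀ {x xs k} → Nth {A} x xs k → At xs (suc k) x
  nth⇒At i with nth-split i
  ... | pre , suf , eq , len = pre , suf , eq , cong suc len

  At⇒nth : ∀ {x xs k} → At xs (suc k) x → Nth {A} x xs k
  At⇒nth (pre , suf , refl , refl) = nth-++ pre

  nth-∈ : ∀ {x xs k} → Nth {A} x xs k → x ∈ xs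
  nth-∈ here = here refl
  nth-∈ (there i) = there (nth-∈ i)

  ∈-nth : ∀ {x xs} → x ∈ xs → ∃ λ k → Nth {A} x xs k
  ∈-nth (here refl) = 0 , here
  ∈-nth (there i) with ∈-nth i
  ... | k , j = suc k , there j

  nth-functional : ∀ {x y xs k} → Nth {A} x xs k → Nth y xs k → x ≡ y
  nth-functional here here = refl
  nth-functional (there i) (there j) = nth-functional i j

  nth-< : ∀ {x xs k} → Nth {A} x xs k → k < length xs
  nth-< here = s≤s z≤n
  nth-< (there i) = s≤s (nth-< i)

  <-nth : ∀ {xs k} → k < length xs → ∃ λ x → Nth {A} x xs k
  <-nth {x ∷ xs} {zero} _ = x , here
  <-nth {_ ∷ xs} {suc k} (s≤s lt) with <-nth lt
  ... | x , i = x , there i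

  nth-unique : ∀ {x xs k l} → Unique xs → Nth {A} x xs k → Nth x xs l → k ≡ l
  nth-unique u here here = refl
  nth-unique (u ∷ _) here (there j) = ⊥-elim (All.lookup u (nth-∈ j) refl)
  nth-unique (u ∷ _) (there i) here = ⊥-elim (All.lookup u (nth-∈ i) refl)
  nth-unique (_ ∷ u) (there i) (there j) = cong suc (nth-unique u i j)

nth-map : ∀ {A B : Set} {x xs k} (f : A → B) → Nth x xs k → Nth (f x) (map f xs) k
nth-map f here = here
nth-map f (there i) = there (nth-map f i)

nth-pos : ∀ {v xs} → v ∈ xs → Nth v xs (pos v xs)
nth-pos {v} {x ∷ xs} v∈ with x ≟ v
... | yes refl rewrite ≡ᵇ-true {x} refl = here
nth-pos {v} {x ∷ xs} (here eq) | no x≢v = ⊥-elim (x≢v (sym eq))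
nth-pos {v} {x ∷ xs} (there v∈) | no x≢v rewrite ≡ᵇ-false x≢v = there (nth-pos v∈)

pos-nth : ∀ {v xs k} → Unique xs → Nth v xs k → pos v xs ≡ k
pos-nth u i = nth-unique u (nth-pos (nth-∈ i)) i

pos-injective : ∀ {u v xs} → u ∈ xs → v ∈ xs → pos u xs ≡ pos v xs → u ≡ v
pos-injective {v = v} {xs} u∈ v∈ eq = nth-functional (nth-pos u∈) (subst (Nth v xs) (sym eq) (nth-pos v∈))

pos-++ˡ : ∀ {v xs} ys → v ∈ xs → pos v (xs ++ ys) ≡ pos v xs
pos-++ˡ {v} {x ∷ xs} ys v∈ with x ≟ v
... | yes refl rewrite ≡ᵇ-true {x} refl = refl
pos-++ˡ {v} {x ∷ xs} ys (here eq) | no x≢v = ⊥-elim (x≢v (sym eq))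
pos-++ˡ {v} {x ∷ xs} ys (there v∈) | no x≢v rewrite ≡ᵇ-false x≢v = cong suc (pos-++ˡ ys v∈)

pos-++ʳ : ∀ {v} xs ys → v ∉ xs → pos v (xs ++ ys) ≡ length xs + pos v ys
pos-++ʳ [] ys v∉ = refl
pos-++ʳ {v} (x ∷ xs) ys v∉ rewrite ≡ᵇ-false {x} {v} (λ e → v∉ (here (sym e))) =
  cong suc (pos-++ʳ xs ys (v∉ ∘ there))

pos-map : ∀ (f : ℕ → ℕ) {u v} → (∀ x → (f x ≡ᵇ v) ≡ (x ≡ᵇ u)) → ∀ xs → pos v (map f xs) ≡ pos u xs
pos-map f eq [] = refl
pos-map f {u} {v} eq (x ∷ xs) rewrite eq x with x ≡ᵇ u
... | true = refl
... | false = cong suc (pos-map f eq xs)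

-- `pos` sends an absent value to the length of the list. After the common head is deleted, the
-- position functions therefore still agree at the deleted value; this is where equal lengths enter.
pos-ext : ∀ {xs ys} → Unique xs → Unique ys → length xs ≡ length ys →
  (∀ {v} → v ∈ xs → v ∈ ys) → (∀ {v} → v ∈ ys → v ∈ xs) →
  (∀ v → pos v xs ≡ pos v ys) → xs ≡ ys
pos-ext {[]} {[]} _ _ _ _ _ _ = refl
pos-ext {x ∷ xs} {y ∷ ys} ux uy len f g eq with nth-functional y-first here
  where
  y-first : Nth y (x ∷ xs) 0
  y-first = subst (Nth y (x ∷ xs)) (trans (eq y) (pos-nth uy here)) (nth-pos (g (here refl)))
pos-ext {x ∷ xs} {.x ∷ ys} (x∉ ∷ ux) (y∉ ∷ uy) len f g eq | refl =
  cong (x ∷_) (pos-ext ux uy (suc-injective len) f' g' eq')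
  where
  f' : ∀ {v} → v ∈ xs → v ∈ ys
  f' v∈ with f (there v∈)
  ... | here refl = ⊥-elim (All.lookup x∉ v∈ refl)
  ... | there v∈' = v∈'
  g' : ∀ {v} → v ∈ ys → v ∈ xs
  g' v∈ with g (there v∈)
  ... | here refl = ⊥-elim (All.lookup y∉ v∈ refl)
  ... | there v∈' = v∈'
  absent : ∀ {x zs} → All (x ≢_) zs → x ∉ zs
  absent (p ∷ _) (here refl) = p refl
  absent (_ ∷ ps) (there i) = absent ps i
  pos-absent : ∀ {x} zs → x ∉ zs → pos x zs ≡ length zs
  pos-absent [] _ = refl
  pos-absent {x} (z ∷ zs) n rewrite ≡ᵇ-false {z} {x} (λ e → n (here (sym e))) = cong suc (pos-absent zs (n ∘ there))
  eq' : ∀ v → pos v xs ≡ pos v ys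
  eq' v with x ≟ v
  ... | yes refl = trans (pos-absent xs (absent x∉))
          (trans (suc-injective len) (sym (pos-absent ys (absent y∉))))
  ... | no x≢v = suc-injective (subst (λ b → (if b then 0 else suc (pos v xs)) ≡ (if b then 0 else suc (pos v ys)))
          (≡ᵇ-false x≢v) (eq v))

∈-range1⁺ : ∀ {n v} → 1 ≤ v → v ≤ n → v ∈ range1 n
∈-range1⁺ (s≤s z≤n) v≤n = ∈-map⁺ suc (∈-upTo⁺ v≤n)

∈-range1⁻ : ∀ {n v} → v ∈ range1 n → 1 ≤ v × v ≤ n
∈-range1⁻ v∈ with ∈-map⁻ suc v∈
... | x , x∈ , refl = s≤s z≤n , ∈-upTo⁻ x∈

unique-range1 : ∀ n → Unique (range1 n)
unique-range1 n = Unique.map⁺ suc-injective (Unique.upTo⁺ n)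

perm-map : ∀ {n w} (f g : ℕ → ℕ) → (∀ x → g (f x) ≡ x) → (∀ x → f (g x) ≡ x) →
  (∀ {x} → 1 ≤ x → x ≤ n → 1 ≤ f x × f x ≤ n) → (∀ {x} → 1 ≤ x → x ≤ n → 1 ≤ g x × g x ≤ n) →
  IsPerm n w → IsPerm n (map f w)
perm-map {n} f g gf fg fr gr p = ↭-trans (map⁺ f p)
  (∼bag⇒↭ (unique∧set⇒bag
    (Unique.map⁺ (λ {x} {y} e → trans (sym (gf x)) (trans (cong g e) (gf y))) (unique-range1 n))
    (unique-range1 n)
    (mk⇔ to from)))
  where
  to : ∀ {x} → x ∈ map f (range1 n) → x ∈ range1 n
  to x∈ with ∈-map⁻ f x∈
  ... | y , y∈ , refl = let a , b = ∈-range1⁻ y∈ ; c , d = fr a b in ∈-range1⁺ c d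
  from : ∀ {x} → x ∈ range1 n → x ∈ map f (range1 n)
  from {x} x∈ = let a , b = ∈-range1⁻ x∈ ; c , d = gr a b in
    subst (_∈ map f (range1 n)) (fg x) (∈-map⁺ f (∈-range1⁺ c d))

module Perm {n : ℕ} {w : List ℕ} (p : IsPerm n w) where

  unique : Unique w
  unique = ↭ₛ.Unique-resp-↭ (setoid ℕ) (↭⇒↭ₛ (↭-sym p)) (unique-range1 n)

  member : ∀ {v} → 1 ≤ v → v ≤ n → v ∈ w
  member a b = ∈-resp-↭ (↭-sym p) (∈-range1⁺ a b)

  bounds : ∀ {v} → v ∈ w → 1 ≤ v × v ≤ n
  bounds v∈ = ∈-range1⁻ (∈-resp-↭ p v∈)

  injective : ∀ {u v} → 1 ≤ u → u ≤ n → 1 ≤ v → v ≤ n → pos u w ≡ pos v w → u ≡ v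
  injective a b c d = pos-injective (member a b) (member c d)

  nth : ∀ {v} → 1 ≤ v → v ≤ n → Nth v w (pos v w)
  nth a b = nth-pos (member a b)

perm-ext : ∀ {n w w'} → IsPerm n w → IsPerm n w' → (∀ v → pos v w ≡ pos v w') → w ≡ w'
perm-ext p p' = pos-ext (Perm.unique p) (Perm.unique p') (trans (↭-length p) (sym (↭-length p')))
  (λ v∈ → ∈-resp-↭ (↭-trans p (↭-sym p')) v∈) (λ v∈ → ∈-resp-↭ (↭-trans p' (↭-sym p)) v∈)

-- Bisimulations and Yamanouchi pairs of rows

-- One nontrivial move D_i, read off the positions a, b, c of the values i-1, i, i+1:
-- R says that two positions are pistoled, and a tilde marks the moves of d̃.
data Tri (R : ℕ → ℕ → Set) (a b c : ℕ) : ℕ → ℕ → ℕ → Set where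
  bac  : b < a → a < c → ¬ R b c → Tri R a b c a c b
  cab  : c < a → a < b → ¬ R c b → Tri R a b c a c b
  acb  : a < c → c < b → ¬ R a b → Tri R a b c b a c
  bca  : b < c → c < a → ¬ R b a → Tri R a b c b a c
  bac~ : b < a → a < c → R b c → Tri R a b c b c a
  cab~ : c < a → a < b → R c b → Tri R a b c b c a
  acb~ : a < c → c < b → R a b → Tri R a b c c a b
  bca~ : b < c → c < a → R b a → Tri R a b c c a b

module _ {R : ℕ → ℕ → Set} {a b c a' b' c' : ℕ} where

  tri-cab : Tri R a b c a' b' c' → c < a → a < b → ¬ R c b →
    a' ≡ a × b' ≡ c × c' ≡ b
  tri-cab (bac p _ _)  _ y _ = ⊥-elim (<-asym p y)
  tri-cab (cab _ _ _)  _ _ _ = refl , refl , refl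
  tri-cab (acb p _ _)  x _ _ = ⊥-elim (<-asym p x)
  tri-cab (bca p _ _)  x y _ = ⊥-elim (<-asym p (<-trans x y))
  tri-cab (bac~ p _ _) _ y _ = ⊥-elim (<-asym p y)
  tri-cab (cab~ _ _ r) _ _ n = ⊥-elim (n r)
  tri-cab (acb~ p _ _) x _ _ = ⊥-elim (<-asym p x)
  tri-cab (bca~ p _ _) x y _ = ⊥-elim (<-asym p (<-trans x y))

  tri-bca : Tri R a b c a' b' c' → b < c → c < a → ¬ R b a →
    a' ≡ b × b' ≡ a × c' ≡ c
  tri-bca (bac _ p _)  _ y _ = ⊥-elim (<-asym p y)
  tri-bca (cab _ p _)  x y _ = ⊥-elim (<-asym p (<-trans x y))
  tri-bca (acb p _ _)  _ y _ = ⊥-elim (<-asym p y)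
  tri-bca (bca _ _ _)  _ _ _ = refl , refl , refl
  tri-bca (bac~ _ p _) _ y _ = ⊥-elim (<-asym p y)
  tri-bca (cab~ _ p _) x y _ = ⊥-elim (<-asym p (<-trans x y))
  tri-bca (acb~ _ p _) x _ _ = ⊥-elim (<-asym p x)
  tri-bca (bca~ _ _ r) _ _ n = ⊥-elim (n r)

  -- In this order `d` leaves the value i+1 in place, while `d̃` moves it to the old position of i.
  -- The difference is what detects a jam in rows of length two.
  tri-bca-R : Tri R a b c a' b' c' → b < c → c < a → R b a → c' ≡ b
  tri-bca-R (bac _ p _)  _ y _ = ⊥-elim (<-asym p y)
  tri-bca-R (cab _ p _)  x y _ = ⊥-elim (<-asym p (<-trans x y))
  tri-bca-R (acb _ p _)  x _ _ = ⊥-elim (<-asym p x)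
  tri-bca-R (bca _ _ n)  _ _ r = ⊥-elim (n r)
  tri-bca-R (bac~ _ p _) _ y _ = ⊥-elim (<-asym p y)
  tri-bca-R (cab~ _ p _) x y _ = ⊥-elim (<-asym p (<-trans x y))
  tri-bca-R (acb~ _ p _) x _ _ = ⊥-elim (<-asym p x)
  tri-bca-R (bca~ _ _ _) _ _ _ = refl

  tri-sym : (∀ {x y} → ¬ R x y) → Tri R a b c a' b' c' → Tri R a' b' c' a b c
  tri-sym n (bac p q _)  = cab p q n
  tri-sym n (cab p q _)  = bac p q n
  tri-sym n (acb p q _)  = bca p q n
  tri-sym n (bca p q _)  = acb p q n
  tri-sym n (bac~ _ _ r) = ⊥-elim (n r)
  tri-sym n (cab~ _ _ r) = ⊥-elim (n r)
  tri-sym n (acb~ _ _ r) = ⊥-elim (n r)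
  tri-sym n (bca~ _ _ r) = ⊥-elim (n r)

-- The moves that remain when the value i sits rightmost of the three. Each case records the new
-- position of i+1, which becomes the first entry of a shortened row in the last sinking step.
data LargestMiddle (R : ℕ → ℕ → Set) (a b c a' b' c' : ℕ) : Set where
  cab  : c < a → ¬ R c b → a' ≡ a → b' ≡ c → c' ≡ b → LargestMiddle R a b c a' b' c'
  acb  : c' ≡ c → LargestMiddle R a b c a' b' c'
  cab~ : c < a → R c b → c' ≡ a → LargestMiddle R a b c a' b' c'
  acb~ : a < c → R a b → c' ≡ b → LargestMiddle R a b c a' b' c'

tri-largestMiddle : ∀ {R a b c a' b' c'} → Tri R a b c a' b' c' → a < b → c < b →
  LargestMiddle R a b c a' b' c'
tri-largestMiddle (bac p _ _)  x _ = ⊥-elim (<-asym p x)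
tri-largestMiddle (cab p _ n)  _ _ = cab p n refl refl refl
tri-largestMiddle (acb _ _ _)  _ _ = acb refl
tri-largestMiddle (bca p _ _)  _ y = ⊥-elim (<-asym p y)
tri-largestMiddle (bac~ p _ _) x _ = ⊥-elim (<-asym p x)
tri-largestMiddle (cab~ p _ r) _ _ = cab~ p r refl
tri-largestMiddle (acb~ p _ r) _ _ = acb~ p r refl
tri-largestMiddle (bca~ p _ _) _ y = ⊥-elim (<-asym p y)

Mid : (ℕ → ℕ) → ℕ → Set
Mid q h = (q h < q (1 + h) × q (1 + h) < q (2 + h))
        ⊎ (q (2 + h) < q (1 + h) × q (1 + h) < q h)

cab⇒¬Mid : ∀ q h → q (2 + h) < q h → q h < q (1 + h) → ¬ Mid q h
cab⇒¬Mid q h x y (inj₁ (u , v)) = <-asym (<-trans u v) x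
cab⇒¬Mid q h x y (inj₂ (u , v)) = <-asym v y

bca⇒¬Mid : ∀ q h → q (1 + h) < q (2 + h) → q (2 + h) < q h → ¬ Mid q h
bca⇒¬Mid q h x y (inj₁ (u , v)) = <-asym (<-trans u v) y
bca⇒¬Mid q h x y (inj₂ (u , v)) = <-asym u x

-- The move D_i with i = h + 1.
record Move (R : ℕ → ℕ → Set) (h : ℕ) (q q' : ℕ → ℕ) : Set where
  field
    tri   : Tri R (q h) (q (1 + h)) (q (2 + h)) (q' h) (q' (1 + h)) (q' (2 + h))
    frame : ∀ v → v ≢ h → v ≢ 1 + h → v ≢ 2 + h → q' v ≡ q v
open Move

descent-transfer : ∀ {x y} (p : ℕ → ℕ) {v} → (p v < p (suc v) → x < y) → p v ≢ p (suc v) →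
  y < x → p (suc v) < p v
descent-transfer p {v} f ne lt with <-cmp (p v) (p (suc v))
... | tri< a _ _ = ⊥-elim (<-asym lt (f a))
... | tri≈ _ e _ = ⊥-elim (ne e)
... | tri> _ _ c = c

-- The value i lies between its neighbours exactly when the signature agrees at i-1 and i, so
-- fillings with equal signatures are fixed by the same moves.
mid-transfer : ∀ {n} (q p : ℕ → ℕ) →
  (∀ {v} → 1 ≤ v → v < n → p v < p (suc v) → q v < q (suc v)) →
  (∀ {v} → 1 ≤ v → v < n → q v < q (suc v) → p v < p (suc v)) →
  (∀ {v} → 1 ≤ v → v < n → q v ≢ q (suc v)) →
  ∀ {h} → 1 ≤ h → 2 + h ≤ n → Mid p h → Mid q h
mid-transfer q p f g ne 1≤h b (inj₁ (x , y)) = inj₁ (f 1≤h (<⇒≤ b) x , f (s≤s z≤n) b y)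
mid-transfer q p f g ne {h} 1≤h b (inj₂ (x , y)) =
  inj₂ (descent-transfer q (g (s≤s z≤n) b) (ne (s≤s z≤n) b) x
       , descent-transfer q (g 1≤h (<⇒≤ b)) (ne 1≤h (<⇒≤ b)) y)

-- `detʳ` and `detˡ` make `S` a one-to-one correspondence up to pointwise equality. The signature
-- fields speak of ascents only, as descents follow by injectivity. In `step` only the left side is
-- assumed to move, since by `mid-transfer` the right side then moves too.
record Bisim (n : ℕ) (R R' : ℕ → ℕ → Set) (S : (ℕ → ℕ) → (ℕ → ℕ) → Set) : Set₁ where
  field
    injˡ : ∀ {q p} → S q p → ∀ {u v} → 1 ≤ u → u ≤ n → 1 ≤ v → v ≤ n → q u ≡ q v → u ≡ v
    injʳ : ∀ {q p} → S q p → ∀ {u v} → 1 ≤ u → u ≤ n → 1 ≤ v → v ≤ n → p u ≡ p v → u ≡ v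
    sigʳ : ∀ {q p} → S q p → ∀ {v} → 1 ≤ v → v < n → q v < q (suc v) → p v < p (suc v)
    sigˡ : ∀ {q p} → S q p → ∀ {v} → 1 ≤ v → v < n → p v < p (suc v) → q v < q (suc v)
    step : ∀ {q p} → S q p → ∀ {h} → 1 ≤ h → 2 + h ≤ n → ¬ Mid q h →
           Σ (ℕ → ℕ) λ q' → Σ (ℕ → ℕ) λ p' → S q' p' × Move R h q q' × Move R' h p p'
    detʳ : ∀ {q p q' p'} → S q p → S q' p' → (∀ v → q v ≡ q' v) → ∀ v → p v ≡ p' v
    detˡ : ∀ {q p q' p'} → S q p → S q' p' → (∀ v → p v ≡ p' v) → ∀ v → q v ≡ q' v

  apartʳ : ∀ {q p} → S q p → ∀ {v} → 1 ≤ v → v < n → p v ≢ p (suc v)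
  apartʳ s 1≤v v<n e = 1+n≢n (sym (injʳ s 1≤v (<⇒≤ v<n) (s≤s z≤n) v<n e))

  sig>ʳ : ∀ {q p} → S q p → ∀ {v} → 1 ≤ v → v < n → q (suc v) < q v → p (suc v) < p v
  sig>ʳ {p = p} s 1≤v v<n =
    descent-transfer p (sigˡ s 1≤v v<n) (apartʳ s 1≤v v<n)

flip-Bisim : ∀ {n R R' S} → Bisim n R R' S → Bisim n R' R (λ p q → S q p)
flip-Bisim {n} {R} {R'} {S} B = record
  { injˡ = injʳ ; injʳ = injˡ ; sigˡ = sigʳ ; sigʳ = sigˡ ; detˡ = detʳ ; detʳ = detˡ
  ; step = λ {p} {q} s 1≤h b ¬mid →
      let q' , p' , s' , t , t' = step s 1≤h b λ m → ¬mid (mid-transfer p q (sigʳ s) (sigˡ s) (apartʳ s) 1≤h b m)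
      in p' , q' , s' , t' , t }
  where open Bisim B

IntervalClosed : (ℕ → ℕ → Set) → Set
IntervalClosed R = ∀ {x y x' y'} → x ≤ x' → x' ≤ y' → y' ≤ y → R x y → R x' y'

-- a and b list the positions of the values filling two rows of length k.
record Yamanouchi (R : ℕ → ℕ → Set) (k : ℕ) (a b : ℕ → ℕ) : Set where
  field
    asc-a   : ∀ j → suc j < k → a j < a (suc j)
    asc-b   : ∀ j → suc j < k → b j < b (suc j)
    b<a     : ∀ j → j < k → b j < a j
    no-jam  : ∀ j → suc j < k → ¬ R (b j) (a (suc j))
open Yamanouchi

-- Separates a row of positions from the values filling it: sinking or raising a value relabels a
-- row, while its positions stay.
record Occupies (q : ℕ → ℕ) (l k : ℕ) (a : ℕ → ℕ) : Set where
  constructor occupies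
  field
    at : ∀ j → j < k → q (j + l) ≡ a j
open Occupies

occupies-tail : ∀ {q l k a} → Occupies q l (suc k) a → Occupies q (suc l) k (a ∘ suc)
occupies-tail {q} {l} o = occupies λ j j<k → trans (cong q (+-suc j l)) (at o (suc j) (s≤s j<k))

occupies-init : ∀ {q l k a} → Occupies q l (suc k) a → Occupies q l k a
occupies-init o = occupies λ j j<k → at o j (m<n⇒m<1+n j<k)

ascending : ∀ (a : ℕ → ℕ) {k} → (∀ j → suc j < k → a j < a (suc j)) →
  ∀ {i j} → i ≤ j → j < k → a i ≤ a j
ascending a asc {i} {zero} z≤n _ = ≤-refl
ascending a asc {i} {suc j} i≤j j<k with m≤n⇒m<n∨m≡n i≤j
... | inj₂ refl = ≤-refl
... | inj₁ (s≤s i≤j') = ≤-trans (ascending a asc i≤j' (<⇒≤ j<k)) (<⇒≤ (asc j j<k))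

-- b0, which starts directly above the values of a, has been moved down just above a j.
record Sunk (k l : ℕ) (a : ℕ → ℕ) (b0 : ℕ) (q₀ q : ℕ → ℕ) (j : ℕ) : Set where
  field
    below : ∀ i → i ≤ j → q (i + l) ≡ a i
    moving  : q (suc j + l) ≡ b0
    above : ∀ i → j < i → i < k → q (suc i + l) ≡ a i
    rest  : ∀ v → k + l < v → q v ≡ q₀ v

-- The value z, which starts directly below the values of b, has been moved up just above b (j - 1).
record Raised (k l z : ℕ) (b : ℕ → ℕ) (q₀ q : ℕ → ℕ) (j : ℕ) : Set where
  field
    below : ∀ i → i < j → q (i + l) ≡ b i
    moving  : q (j + l) ≡ z
    above : ∀ i → j ≤ i → i < k → q (suc i + l) ≡ b i
    rest  : ∀ v → v < l → q v ≡ q₀ v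

-- The three consecutive values sit at `a j`, `a (suc j)`, `b0`, and the positions are ordered `b0`,
-- `a j`, `a (suc j)`. This is pattern `cab` with extremes not pistoled, so the upper two values are
-- swapped and the value at `b0` drops by one.
sink-side : ∀ {R k l a b0 q₀ q q' j} → Sunk k l a b0 q₀ q (suc j) → suc j < k →
  Move R (j + l) q q' → b0 < a j → a j < a (suc j) → ¬ R b0 (a (suc j)) →
  Sunk k l a b0 q₀ q' j
sink-side {R} {k} {l} {a} {b0} {q₀} {q} {q'} {j} s j<k st x y n = record
  { below = below' ; moving = trans (proj₁ (proj₂ eqs)) moving ; above = above'
  ; rest = λ v lt → trans (frame st v
      (>⇒≢ (<-trans (+-monoˡ-< l (<-trans (n<1+n j) j<k)) lt))
      (>⇒≢ (<-trans (+-monoˡ-< l j<k) lt))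
      (>⇒≢ (≤-<-trans (+-monoˡ-≤ l j<k) lt))) (rest v lt) }
  where
  open Sunk s
  e₀ = below j (n≤1+n j)
  e₁ = below (suc j) ≤-refl
  eqs = tri-cab (tri st)
    (subst₂ _<_ (sym moving) (sym e₀) x)
    (subst₂ _<_ (sym e₀) (sym e₁) y)
    (λ r → n (subst₂ R moving e₁ r))
  below' : ∀ i → i ≤ j → q' (i + l) ≡ a i
  below' i i≤j with m≤n⇒m<n∨m≡n i≤j
  ... | inj₂ refl = trans (proj₁ eqs) e₀
  ... | inj₁ i<j = trans (frame st (i + l)
          (<⇒≢ (+-monoˡ-< l i<j)) (<⇒≢ (+-monoˡ-< l (m<n⇒m<1+n i<j)))
          (<⇒≢ (+-monoˡ-< l (m<n⇒m<1+n (m<n⇒m<1+n i<j))))) (below i (m≤n⇒m≤1+n i≤j))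
  above' : ∀ i → j < i → i < k → q' (suc i + l) ≡ a i
  above' i j<i i<k with m≤n⇒m<n∨m≡n j<i
  ... | inj₂ refl = trans (proj₂ (proj₂ eqs)) e₁
  ... | inj₁ j<<i = trans (frame st (suc i + l)
          (>⇒≢ (+-monoˡ-< l (<-trans j<i (n<1+n i)))) (>⇒≢ (+-monoˡ-< l (s<s j<i)))
          (>⇒≢ (+-monoˡ-< l (s<s j<<i)))) (above i j<<i i<k)

-- Dual to `sink-side`: the values at `z`, `b j`, `b (suc j)` form pattern `bca`, and the lower two
-- are swapped.
raise-side : ∀ {R k l z b q₀ q q' j} → Raised k l z b q₀ q j → suc j < k →
  Move R (j + l) q q' → b j < b (suc j) → b (suc j) < z → ¬ R (b j) z →
  Raised k l z b q₀ q' (suc j)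
raise-side {R} {k} {l} {z} {b} {q₀} {q} {q'} {j} s j<k st x y n = record
  { below = below' ; moving = trans (proj₁ (proj₂ eqs)) moving ; above = above'
  ; rest = λ v lt → trans (frame st v
      (<⇒≢ (<-≤-trans lt (m≤n+m l j)))
      (<⇒≢ (<-≤-trans lt (m≤n+m l (1 + j))))
      (<⇒≢ (<-≤-trans lt (m≤n+m l (2 + j))))) (rest v lt) }
  where
  open Raised s
  e₀ = above j ≤-refl (<-trans (n<1+n j) j<k)
  e₁ = above (suc j) (n≤1+n j) j<k
  eqs = tri-bca (tri st)
    (subst₂ _<_ (sym e₀) (sym e₁) x)
    (subst₂ _<_ (sym e₁) (sym moving) y)
    (λ r → n (subst₂ R e₀ moving r))
  below' : ∀ i → i < suc j → q' (i + l) ≡ b i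
  below' i (s≤s i≤j) with m≤n⇒m<n∨m≡n i≤j
  ... | inj₂ refl = trans (proj₁ eqs) e₀
  ... | inj₁ i<j = trans (frame st (i + l)
          (<⇒≢ (+-monoˡ-< l i<j)) (<⇒≢ (+-monoˡ-< l (m<n⇒m<1+n i<j)))
          (<⇒≢ (+-monoˡ-< l (m<n⇒m<1+n (m<n⇒m<1+n i<j))))) (below i i<j)
  above' : ∀ i → suc j ≤ i → i < k → q' (suc i + l) ≡ b i
  above' i j<i i<k with m≤n⇒m<n∨m≡n j<i
  ... | inj₂ refl = trans (proj₂ (proj₂ eqs)) e₁
  ... | inj₁ j<<i = trans (frame st (suc i + l)
          (>⇒≢ (+-monoˡ-< l (<-trans j<i (n<1+n i)))) (>⇒≢ (+-monoˡ-< l (s<s j<i)))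
          (>⇒≢ (+-monoˡ-< l (s<s j<<i)))) (above i (<⇒≤ j<i) i<k)

Sinkable : (ℕ → ℕ → Set) → (ℕ → ℕ) → ℕ → ℕ → Set
Sinkable R a b0 j = b0 < a j × a j < a (suc j) × ¬ R b0 (a (suc j))

Raisable : (ℕ → ℕ → Set) → ℕ → (ℕ → ℕ) → ℕ → Set
Raisable R z b j = b j < b (suc j) × b (suc j) < z × ¬ R (b j) z

-- Transfer of the condition on two rows through a bisimulation

module Transfer {n R R' S} (B : Bisim n R R' S)
    (closed : IntervalClosed R) (closed' : IntervalClosed R') where
  open Bisim B

  -- `step` only promises some paired move. The two `Sinkable` hypotheses identify it as the same
  -- swap on both sides, so the fillings stay related by `S` and both keep the sunk form. The
  -- counter `d` is the number of steps from `k` down to `j`.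
  sink : ∀ {k l q p a a' b0 b0'} → S q p → 1 ≤ l → suc k + l ≤ n →
    Sunk (suc k) l a b0 q q k → Sunk (suc k) l a' b0' p p k →
    ∀ d j → d + j ≡ k →
    (∀ i → j ≤ i → suc i < suc k → Sinkable R a b0 i) →
    (∀ i → j ≤ i → suc i < suc k → Sinkable R' a' b0' i) →
    Σ (ℕ → ℕ) λ q₁ → Σ (ℕ → ℕ) λ p₁ → S q₁ p₁ ×
      Sunk (suc k) l a b0 q q₁ j × Sunk (suc k) l a' b0' p p₁ j
  sink {q = q} {p} s 1≤l bd i₀ i₀' zero j refl ok ok' = q , p , s , i₀ , i₀'
  sink {k} {l} {q} {p} s 1≤l bd i₀ i₀' (suc d) j refl ok ok'
    with sink s 1≤l bd i₀ i₀' d (suc j) (+-suc d j)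
      (λ i j<i → ok i (<⇒≤ j<i)) (λ i j<i → ok' i (<⇒≤ j<i))
  ... | q₁ , p₁ , s₁ , k₁ , k₁' =
    let j<k = s<s (s≤s (m≤n+m j d))
        x , y , z = ok j ≤-refl j<k
        x' , y' , z' = ok' j ≤-refl j<k
        open Sunk k₁
        e = below j (n≤1+n j)
        q₂ , p₂ , s₂ , t , t' = step s₁ {j + l} (≤-trans 1≤l (m≤n+m l j))
          (≤-trans (+-monoˡ-≤ l j<k) bd)
          (cab⇒¬Mid q₁ (j + l) (subst₂ _<_ (sym moving) (sym e) x)
            (subst₂ _<_ (sym e) (sym (below (suc j) ≤-refl)) y))
    in q₂ , p₂ , s₂ , sink-side k₁ j<k t x y z , sink-side k₁' j<k t' x' y' z'

  raise : ∀ {k l q p z z' b b'} → S q p → 1 ≤ l → k + l ≤ n →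
    Raised k l z b q q 0 → Raised k l z' b' p p 0 →
    (∀ i → suc i < k → Raisable R z b i) →
    (∀ i → suc i < k → Raisable R' z' b' i) →
    ∀ j → j < k →
    Σ (ℕ → ℕ) λ q₁ → Σ (ℕ → ℕ) λ p₁ → S q₁ p₁ ×
      Raised k l z b q q₁ j × Raised k l z' b' p p₁ j
  raise {q = q} {p} s 1≤l bd i₀ i₀' ok ok' zero j<k = q , p , s , i₀ , i₀'
  raise {k} {l} {q} {p} s 1≤l bd i₀ i₀' ok ok' (suc j) j<k
    with raise s 1≤l bd i₀ i₀' ok ok' j (<⇒≤ j<k)
  ... | q₁ , p₁ , s₁ , k₁ , k₁' =
    let x , y , z = ok j j<k
        x' , y' , z' = ok' j j<k
        open Raised k₁
        e₁ = above (suc j) (n≤1+n j) j<k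
        q₂ , p₂ , s₂ , t , t' = step s₁ {j + l} (≤-trans 1≤l (m≤n+m l j))
          (≤-trans (+-monoˡ-≤ l j<k) bd)
          (bca⇒¬Mid q₁ (j + l)
            (subst₂ _<_ (sym (above j ≤-refl (<⇒≤ j<k))) (sym e₁) x)
            (subst₂ _<_ (sym e₁) (sym moving) y))
    in q₂ , p₂ , s₂ , raise-side k₁ j<k t x y z , raise-side k₁' j<k t' x' y' z'

  -- The values of the second row are lb, ..., k + lb - 1, so the bound says that the last of them
  -- is at most n.
  Claim : ℕ → Set
  Claim k = ∀ {la lb q p a b a' b'} → lb ≡ k + la → 1 ≤ la → k + lb ≤ suc n → S q p →
    Occupies q la k a → Occupies q lb k b → Occupies p la k a' → Occupies p lb k b' →
    Yamanouchi R k a b → Yamanouchi R' k a' b'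

  ascending-transfer : ∀ {k l q p a a'} → 1 ≤ l → k + l ≤ suc n → S q p →
    Occupies q l k a → Occupies p l k a' →
    (∀ j → suc j < k → a j < a (suc j)) → (∀ j → suc j < k → a' j < a' (suc j))
  ascending-transfer {k} {l} 1≤l bd s o o' asc j j<k =
    subst₂ _<_ (at o' j (<⇒≤ j<k)) (at o' (suc j) j<k)
      (sigʳ s (≤-trans 1≤l (m≤n+m l j)) (≤-pred (≤-trans (+-monoˡ-≤ l j<k) bd))
        (subst₂ _<_ (sym (at o j (<⇒≤ j<k))) (sym (at o (suc j) j<k)) (asc j j<k)))

  -- The one obstruction left by the last sinking step. It is silent about `b 0 < a 0`, because one
  -- of the two cases leading here has `a 0 < b 0`.
  Bad : ℕ → (ℕ → ℕ) → (ℕ → ℕ) → Set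
  Bad k a b = R' (b 0) (a 1) × (∀ j → 1 ≤ j → j < k → b j < a j)
      × (∀ j → 1 ≤ j → suc j < k → ¬ R' (b j) (a (suc j)))

  module Induct (k : ℕ) (ih : Claim (suc k)) {la : ℕ} {q p a b a' b' : ℕ → ℕ}
      (1≤la : 1 ≤ la) (bd : 2 + k + (2 + k + la) ≤ suc n) (s : S q p)
      (oa : Occupies q la (2 + k) a) (ob : Occupies q (2 + k + la) (2 + k) b)
      (oa' : Occupies p la (2 + k) a') (ob' : Occupies p (2 + k + la) (2 + k) b')
      (y : Yamanouchi R (2 + k) a b) where

    K = 2 + k
    lb = K + la

    lb≤n : lb ≤ n
    lb≤n = ≤-trans (m≤n+m lb (suc k)) (≤-pred bd)

    asc-a' : ∀ j → suc j < K → a' j < a' (suc j)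
    asc-a' = ascending-transfer 1≤la (m≤n⇒m≤1+n lb≤n) s oa oa' (asc-a y)

    asc-b' : ∀ j → suc j < K → b' j < b' (suc j)
    asc-b' = ascending-transfer (s≤s z≤n) bd s ob ob' (asc-b y)

    closed-away : ∀ {R : ℕ → ℕ → Set} {a : ℕ → ℕ} → IntervalClosed R →
      (∀ j → suc j < K → a j < a (suc j)) → ∀ {x x₁ i j} → x ≤ x₁ → x₁ ≤ a i → i ≤ j → j < K →
      ¬ R x₁ (a i) → ¬ R x (a j)
    closed-away {a = a} c asc x≤ ≤y i≤j j<K ¬r r = ¬r (c x≤ ≤y (ascending a asc i≤j j<K) r)

    -- The weaker condition obtained by dropping the first value of a.
    weak : Yamanouchi R' (suc k) (a' ∘ suc) b'
    weak = ih (sym (+-suc (suc k) la)) (s≤s z≤n) (<⇒≤ bd) s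
      (occupies-tail oa) (occupies-init ob)
      (occupies-tail oa') (occupies-init ob')
      record
        { asc-a = λ j j<k → asc-a y (suc j) (s<s j<k)
        ; asc-b = λ j j<k → asc-b y j (m<n⇒m<1+n j<k)
        ; b<a = λ j j<k → <-trans (b<a y j (m<n⇒m<1+n j<k)) (asc-a y j (s<s j<k))
        ; no-jam = λ j j<k → closed-away closed (asc-a y) ≤-refl
            (<⇒≤ (<-trans (b<a y j (<-trans (n<1+n j) (m<n⇒m<1+n j<k))) (asc-a y j (m<n⇒m<1+n j<k))))
            (n≤1+n _) (s<s j<k) (no-jam y j (m<n⇒m<1+n j<k)) }

    b<last : ∀ {j} → suc j < K → b (suc j) < a (suc k)
    b<last {j} j<k = <-≤-trans (b<a y (suc j) j<k) (ascending a (asc-a y) (≤-pred j<k) ≤-refl)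

    raised₀ : ∀ {q a b} → Occupies q la K a → Occupies q lb K b →
      Raised K (suc k + la) (a (suc k)) b q q 0
    raised₀ {q} oa ob = record
      { below = λ _ () ; moving = at oa (suc k) ≤-refl
      ; above = λ i _ i<k → trans (cong q (sym (+-suc i (suc k + la)))) (at ob i i<k)
      ; rest = λ _ _ → refl }

    sunk₀ : ∀ {q a b} → Occupies q la K a → Occupies q lb K b →
      Sunk K la a (b 0) q q (suc k)
    sunk₀ {q} oa ob = record
      { below = λ i i≤k → at oa i (s≤s i≤k) ; moving = at ob 0 (s≤s z≤n)
      ; above = λ i k<i i<K → ⊥-elim (<-irrefl refl (<-≤-trans i<K k<i))
      ; rest = λ _ _ → refl }

    -- Raising the last value of row `a` until it lies above `b k` brings the values of `a 0`, ...,
    -- `a k` and of `b 0`, ..., `b k` next to each other. Induction then forbids the jam of `b' 0`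
    -- with `a' 1`; for this the shortened rows must have at least two entries, hence `1 ≤ k`.
    ¬no-jam-first : 1 ≤ k → ¬ Bad K a' b'
    ¬no-jam-first 1≤k (r , lt , nj) =
      let q₁ , p₁ , s₁ , k₁ , k₁' = raised in
      no-jam
        (ih refl 1≤la (≤-trans (+-mono-≤ (n≤1+n (suc k)) (n≤1+n (suc k + la))) bd) s₁
          (unmoved k₁ oa) (occupies (Raised.below k₁)) (unmoved k₁' oa') (occupies (Raised.below k₁'))
          record
            { asc-a = λ j j<k → asc-a y j (m<n⇒m<1+n j<k)
            ; asc-b = λ j j<k → asc-b y j (m<n⇒m<1+n j<k)
            ; b<a = λ j j<k → b<a y j (m<n⇒m<1+n j<k)
            ; no-jam = λ j j<k → no-jam y j (m<n⇒m<1+n j<k) })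
        0 (s≤s 1≤k) r
      where
      -- The pair `b' 0`, `a' 1` is pistoled here, so index 0 goes through `a' 2` and the weaker
      -- condition; `a' 2` is in the row because `1 ≤ k`.
      far : ∀ i → suc i < K → ¬ R' (b' i) (a' (suc k))
      far zero _ = closed-away closed' asc-a' ≤-refl
        (<⇒≤ (<-trans (b<a weak 0 (s≤s z≤n)) (asc-a' 1 (s≤s (s≤s 1≤k)))))
        (s≤s 1≤k) ≤-refl (no-jam weak 0 (s≤s 1≤k))
      far (suc i) i<k = closed-away closed' asc-a' ≤-refl
        (<⇒≤ (b<a weak (suc i) (≤-pred i<k)))
        (≤-pred i<k) ≤-refl (nj (suc i) (s≤s z≤n) i<k)
      ok : ∀ i → suc i < K → Raisable R (a (suc k)) b i
      ok i i<k = asc-b y i i<k , b<last i<k , closed-away closed (asc-a y) ≤-refl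
        (<⇒≤ (<-trans (b<a y i (<⇒≤ i<k)) (asc-a y i i<k))) (≤-pred i<k) ≤-refl (no-jam y i i<k)
      ok' : ∀ i → suc i < K → Raisable R' (a' (suc k)) b' i
      ok' i i<k = asc-b' i i<k ,
        <-≤-trans (lt (suc i) (s≤s z≤n) i<k) (ascending a' asc-a' (≤-pred i<k) ≤-refl) , far i i<k
      raised : Σ (ℕ → ℕ) λ q₁ → Σ (ℕ → ℕ) λ p₁ → S q₁ p₁ ×
        Raised K (suc k + la) (a (suc k)) b q q₁ (suc k) ×
        Raised K (suc k + la) (a' (suc k)) b' p p₁ (suc k)
      raised = raise s (s≤s z≤n) (≤-pred (subst (_≤ suc n) (+-suc K (suc k + la)) bd))
        (raised₀ oa ob) (raised₀ oa' ob') ok ok' (suc k) ≤-refl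
      unmoved : ∀ {q₀ q z a b} → Raised K (suc k + la) z b q₀ q (suc k) →
        Occupies q₀ la K a → Occupies q la (suc k) a
      unmoved k₁ o = occupies λ j j<k →
        trans (Raised.rest k₁ (j + la) (+-monoˡ-< la j<k)) (at o j (m<n⇒m<1+n j<k))

  ¬bad : ∀ k → Claim (suc k) → ∀ {la q p a b a' b'} → 1 ≤ la →
    2 + k + (2 + k + la) ≤ suc n → S q p →
    Occupies q la (2 + k) a → Occupies q (2 + k + la) (2 + k) b →
    Occupies p la (2 + k) a' → Occupies p (2 + k + la) (2 + k) b' →
    Yamanouchi R (2 + k) a b → ¬ Bad (2 + k) a' b'
  -- On the known side D_{la+1} and D_{la+2} are the same swap.
  ¬bad zero ih {la} {q} {p} {a} {b} {a'} {b'} 1≤la bd s oa ob oa' ob' y (r , lt , _) =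
    let a0 = at oa 0 (s≤s z≤n) ; a1 = at oa 1 ≤-refl ; b0 = at ob 0 (s≤s z≤n) ; b1 = at ob 1 ≤-refl
        b0<a0 = subst₂ _<_ (sym b0) (sym a0) (b<a y 0 (s≤s z≤n))
        a0<a1 = subst₂ _<_ (sym a0) (sym a1) (asc-a y 0 ≤-refl)
        b0<b1 = subst₂ _<_ (sym b0) (sym b1) (asc-b y 0 ≤-refl)
        b1<a1 = subst₂ _<_ (sym b1) (sym a1) (b<a y 1 ≤-refl)
        ¬r = λ x → no-jam y 0 ≤-refl (subst₂ R b0 a1 x)
        q₂ , p₂ , s₂ , t , t' = step s {la} 1≤la (<⇒≤ (≤-pred bd)) (cab⇒¬Mid q la b0<a0 a0<a1)
        q₃ , p₃ , s₃ , u , u' = step s {1 + la} (s≤s z≤n) (≤-pred bd) (bca⇒¬Mid q (1 + la) b0<b1 b1<a1)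
        x , y' , z = tri-cab (tri t) b0<a0 a0<a1 ¬r
        x₃ , y₃ , z₃ = tri-bca (tri u) b0<b1 b1<a1 ¬r
        eq : ∀ v → q₂ v ≡ q₃ v
        eq v = case-eq v t u x y' z x₃ y₃ z₃
        b'0<b'1 = asc-b' 0 ≤-refl
        -- On the other side the jam turns the second move into `d̃`, which puts the value 3 + la at
        -- `b' 0`. The first move leaves that value at `b' 1`, yet `detʳ` makes the two results
        -- equal.
        w = tri-bca-R (tri u') (subst₂ _<_ (sym (at ob' 0 (s≤s z≤n))) (sym (at ob' 1 ≤-refl)) b'0<b'1)
              (subst₂ _<_ (sym (at ob' 1 ≤-refl)) (sym (at oa' 1 ≤-refl)) (lt 1 ≤-refl ≤-refl))
              (subst₂ R' (sym (at ob' 0 (s≤s z≤n))) (sym (at oa' 1 ≤-refl)) r)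
        w' = frame t' (3 + la) (>⇒≢ (m≤n+m (suc la) 2)) (>⇒≢ (n≤1+n (2 + la))) (>⇒≢ ≤-refl)
    in <⇒≢ b'0<b'1 (trans (sym (at ob' 0 (s≤s z≤n))) (trans (sym w) (trans (sym (detʳ s₂ s₃ eq (3 + la)))
         (trans w' (at ob' 1 ≤-refl)))))
    where
    open Induct 0 ih 1≤la bd s oa ob oa' ob' y using (asc-b')
    case-eq : ∀ v {q₂ q₃} → Move R la q q₂ → Move R (1 + la) q q₃ →
      q₂ la ≡ q la → q₂ (1 + la) ≡ q (2 + la) → q₂ (2 + la) ≡ q (1 + la) →
      q₃ (1 + la) ≡ q (2 + la) → q₃ (2 + la) ≡ q (1 + la) → q₃ (3 + la) ≡ q (3 + la) →
      q₂ v ≡ q₃ v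
    case-eq v t u x y z x₃ y₃ z₃ with v ≟ la | v ≟ 1 + la | v ≟ 2 + la | v ≟ 3 + la
    ... | yes refl | _ | _ | _ = trans x (sym (frame u v
            (<⇒≢ ≤-refl) (<⇒≢ (m≤n+m (suc v) 1)) (<⇒≢ (m≤n+m (suc v) 2))))
    ... | no _ | yes refl | _ | _ = trans y (sym x₃)
    ... | no _ | no _ | yes refl | _ = trans z (sym y₃)
    ... | no n₀ | no n₁ | no n₂ | yes refl = trans (frame t v n₀ n₁ n₂) (sym z₃)
    ... | no n₀ | no n₁ | no n₂ | no n₃ = trans (frame t v n₀ n₁ n₂) (sym (frame u v n₁ n₂ n₃))
  ¬bad (suc k) ih 1≤la bd s oa ob oa' ob' y bad =
    Induct.¬no-jam-first (suc k) ih 1≤la bd s oa ob oa' ob' y (s≤s z≤n) bad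

  module Finish (k : ℕ) (ih : Claim (suc k)) {la : ℕ} {q p a b a' b' : ℕ → ℕ}
      (1≤la : 1 ≤ la) (bd : 2 + k + (2 + k + la) ≤ suc n) (s : S q p)
      (oa : Occupies q la (2 + k) a) (ob : Occupies q (2 + k + la) (2 + k) b)
      (oa' : Occupies p la (2 + k) a') (ob' : Occupies p (2 + k + la) (2 + k) b')
      (y : Yamanouchi R (2 + k) a b) {q₁ p₁ q₂ p₂ : ℕ → ℕ}
      (k₁ : Sunk (2 + k) la a (b 0) q q₁ 1) (k₁' : Sunk (2 + k) la a' (b' 0) p p₁ 1)
      (s₂ : S q₂ p₂) (t : Move R la q₁ q₂) (t' : Move R' la p₁ p₂) where

    open Induct k ih 1≤la bd s oa ob oa' ob' y
    open Sunk

    e₀ : p₁ la ≡ a' 0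
    e₀ = below k₁' 0 z≤n
    e₁ : p₁ (1 + la) ≡ a' 1
    e₁ = below k₁' 1 ≤-refl
    e₂ : p₁ (2 + la) ≡ b' 0
    e₂ = moving k₁'
    a'0<a'1 : p₁ la < p₁ (1 + la)
    a'0<a'1 = subst₂ _<_ (sym e₀) (sym e₁) (asc-a' 0 (s≤s (s≤s z≤n)))
    b'0<a'1 : p₁ (2 + la) < p₁ (1 + la)
    b'0<a'1 = subst₂ _<_ (sym e₂) (sym e₁) (b<a weak 0 (s≤s z≤n))
    known : Sunk K la a (b 0) q q₂ 0
    known = sink-side k₁ (s≤s (s≤s z≤n)) t (b<a y 0 (s≤s z≤n)) (asc-a y 0 (s≤s (s≤s z≤n)))
      (no-jam y 0 (s≤s (s≤s z≤n)))
    -- The last sinking move is not forced on this side, so the position it gives to the value 2 +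
    -- la is left open. Induction applies to the row starting with it, since on the known side the
    -- same values sit at `a 1`, `a 2`, ....
    a″ : ℕ → ℕ
    a″ zero = p₂ (2 + la)
    a″ (suc j) = a' (2 + j)
    2+j : ∀ j → j + (2 + la) ≡ 2 + j + la
    2+j j = trans (+-suc j (suc la)) (cong suc (+-suc j la))
    oa″ : Occupies p₂ (2 + la) (suc k) a″
    oa″ = occupies λ
      { zero _ → refl
      ; (suc j) j<k → trans (cong p₂ (2+j (suc j))) (trans (frame t' (3 + j + la)
          (>⇒≢ (s≤s (m≤n⇒m≤1+n (m≤n⇒m≤1+n (m≤n+m la j)))))
          (>⇒≢ (s≤s (s≤s (m≤n⇒m≤1+n (m≤n+m la j)))))
          (>⇒≢ (s≤s (s≤s (s≤s (m≤n+m la j))))))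
        (above k₁' (2 + j) (s≤s (s≤s z≤n)) (s≤s j<k))) }
    tail : ∀ {q₀ q b} → (∀ v → K + la < v → q v ≡ q₀ v) → Occupies q₀ lb K b →
      Occupies q (suc lb) (suc k) (b ∘ suc)
    tail r o = occupies λ j j<k → trans (r (j + suc lb) (m≤n+m (suc lb) j)) (at (occupies-tail o) j j<k)
    rest″ : ∀ v → K + la < v → p₂ v ≡ p v
    rest″ v lt = trans (frame t' v
      (>⇒≢ (≤-<-trans (m≤n+m la K) lt))
      (>⇒≢ (≤-<-trans (+-monoˡ-≤ la (s≤s {n = suc k} z≤n)) lt))
      (>⇒≢ (≤-<-trans (+-monoˡ-≤ la (s≤s (s≤s {n = k} z≤n))) lt))) (rest k₁' v lt)
    dropped : Yamanouchi R' (suc k) a″ (b' ∘ suc)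
    dropped = ih (sym (2+j (suc k))) (s≤s z≤n)
      (subst (_≤ suc n) (sym (+-suc (suc k) lb)) bd) s₂
      (occupies λ j j<k → trans (cong q₂ (2+j j))
        (above known (suc j) (s≤s z≤n) (s≤s j<k)))
      (tail (rest known) ob) oa″ (tail rest″ ob')
      record
        { asc-a = λ j j<k → asc-a y (suc j) (s<s j<k)
        ; asc-b = λ j j<k → asc-b y (suc j) (s<s j<k)
        ; b<a = λ j j<k → b<a y (suc j) (s<s j<k)
        ; no-jam = λ j j<k → no-jam y (suc j) (s<s j<k) }
    nj : ∀ j → 1 ≤ j → suc j < K → ¬ R' (b' j) (a' (suc j))
    nj (suc j) _ (s≤s j<k) = no-jam dropped j j<k
    lt : a″ 0 ≤ a' 1 → ∀ j → 1 ≤ j → j < K → b' j < a' j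
    lt le (suc zero) _ _ = <-≤-trans (b<a dropped 0 (s≤s z≤n)) le
    lt le (suc (suc j)) _ (s≤s j<k) = b<a dropped (suc j) j<k
    -- In the four cases `a″ 0` is `a' 1`, `b' 0`, `a' 0`, `a' 1` respectively. The first is the
    -- wanted one; `dropped` always gives `b' 1 < a″ 0`, which refutes the second and turns the
    -- other two into `Bad`.
    cases : LargestMiddle R' (p₁ la) (p₁ (1 + la)) (p₁ (2 + la)) (p₂ la) (p₂ (1 + la)) (p₂ (2 + la)) → Yamanouchi R' K a' b'
    cases (cab c<a ¬r _ _ c'≡) = record
      { asc-a = asc-a' ; asc-b = asc-b'
      ; b<a = λ { zero _ → subst₂ _<_ e₂ e₀ c<a
                ; (suc j) j<k → lt (≤-reflexive (trans c'≡ e₁)) (suc j) (s≤s z≤n) j<k }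
      ; no-jam = λ { zero _ r → ¬r (subst₂ R' (sym e₂) (sym e₁) r)
                   ; (suc j) j<k → nj (suc j) (s≤s z≤n) j<k } }
    cases (acb c'≡) = ⊥-elim (<-asym (asc-b' 0 (s≤s (s≤s z≤n)))
      (subst (b' 1 <_) (trans c'≡ e₂) (b<a dropped 0 (s≤s z≤n))))
    cases (cab~ _ r c'≡) = ⊥-elim (¬bad k ih 1≤la bd s oa ob oa' ob' y
      (subst₂ R' e₂ e₁ r , lt (≤-trans (≤-reflexive (trans c'≡ e₀)) (<⇒≤ (asc-a' 0 (s≤s (s≤s z≤n))))) , nj))
    -- Here `a' 0 < b' 0 < a' 1` with the outer two pistoled, so `b' 0` and `a' 1` are pistoled by
    -- interval closure.
    cases (acb~ a<c r c'≡) = ⊥-elim (¬bad k ih 1≤la bd s oa ob oa' ob' y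
      (subst₂ R' e₂ e₁ (closed' (<⇒≤ a<c) (<⇒≤ b'0<a'1) ≤-refl r)
      , lt (≤-reflexive (trans c'≡ e₁)) , nj))

    result : Yamanouchi R' K a' b'
    result = cases (tri-largestMiddle (tri t') a'0<a'1 b'0<a'1)

  transfer-step : ∀ k → Claim (suc k) → Claim (2 + k)
  transfer-step k ih {la} {_} {q} {p} {a} {b} {a'} {b'} refl 1≤la bd s oa ob oa' ob' y
    -- Sinking stops at index 1: `weak` places `b' 0` before `a' 1` and away from the pistols of
    -- `a' 2`, which settles all moves but the one at index 0.
    with sink s 1≤la lb≤n (sunk₀ oa ob) (sunk₀ oa' ob') k 1 (+-comm k 1) ok ok'
    where
    open Induct k ih 1≤la bd s oa ob oa' ob' y
    ok : ∀ i → 1 ≤ i → suc i < 2 + k → Sinkable R a (b 0) i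
    ok i _ i<k = <-≤-trans (b<a y 0 (s≤s z≤n)) (ascending a (asc-a y) z≤n (<⇒≤ i<k)) , asc-a y i i<k
      , closed-away closed (asc-a y) ≤-refl (<⇒≤ (<-trans (b<a y 0 (s≤s z≤n)) (asc-a y 0 (s≤s (s≤s z≤n)))))
          (s≤s z≤n) i<k (no-jam y 0 (s≤s (s≤s z≤n)))
    ok' : ∀ i → 1 ≤ i → suc i < 2 + k → Sinkable R' a' (b' 0) i
    ok' i 1≤i i<k@(s≤s (s≤s i≤k)) =
      <-≤-trans (b<a weak 0 (s≤s z≤n)) (ascending a' asc-a' 1≤i (<⇒≤ i<k)) , asc-a' i i<k
      , closed-away closed' asc-a' ≤-refl
          (<⇒≤ (<-trans (b<a weak 0 (s≤s z≤n)) (asc-a' 1 (s≤s (s≤s (≤-trans 1≤i i≤k))))))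
          (s≤s 1≤i) i<k (no-jam weak 0 (s≤s (≤-trans 1≤i i≤k)))
  ... | q₁ , p₁ , s₁ , k₁ , k₁' with step s₁ {la} 1≤la bd' (cab⇒¬Mid q₁ la b0<a0 a0<a1)
    where
    bd' : 2 + la ≤ n
    bd' = ≤-trans (+-monoˡ-≤ la (s≤s (s≤s z≤n))) (≤-pred (≤-trans (s≤s (m≤n+m (2 + k + la) (suc k))) bd))
    b0<a0 = subst₂ _<_ (sym (Sunk.moving k₁)) (sym (Sunk.below k₁ 0 z≤n)) (b<a y 0 (s≤s z≤n))
    a0<a1 = subst₂ _<_ (sym (Sunk.below k₁ 0 z≤n)) (sym (Sunk.below k₁ 1 ≤-refl))
              (asc-a y 0 (s≤s (s≤s z≤n)))
  ... | q₂ , p₂ , s₂ , t , t' = Finish.result k ih 1≤la bd s oa ob oa' ob' y k₁ k₁' s₂ t t'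

  transfer : ∀ k → Claim k
  transfer zero _ _ _ _ _ _ _ _ _ = record
    { asc-a = λ _ () ; asc-b = λ _ () ; b<a = λ _ () ; no-jam = λ _ () }
  -- Rows of length one hold consecutive values, so the whole condition is a descent of the
  -- signature.
  transfer (suc zero) refl 1≤la bd s oa ob oa' ob' y = record
    { asc-a = λ { _ (s≤s ()) } ; asc-b = λ { _ (s≤s ()) }
    ; b<a = λ { zero _ → subst₂ _<_ (at ob' 0 ≤-refl) (at oa' 0 ≤-refl) (sig>ʳ s 1≤la (≤-pred bd)
        (subst₂ _<_ (sym (at ob 0 ≤-refl)) (sym (at oa 0 ≤-refl)) (b<a y 0 ≤-refl)))
              ; (suc _) (s≤s ()) }
    ; no-jam = λ { _ (s≤s ()) } }
  transfer (suc (suc k)) = transfer-step k (transfer (suc k))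

-- The elementary moves d and d̃

swapV-left : ∀ x y → swapV x y x ≡ y
swapV-left x y rewrite ≡ᵇ-true {x} refl = refl

swapV-right : ∀ x y → swapV x y y ≡ x
swapV-right x y with y ≟ x
... | yes refl rewrite ≡ᵇ-true {y} refl = refl
... | no y≢x rewrite ≡ᵇ-false y≢x | ≡ᵇ-true {y} refl = refl

swapV-other : ∀ {x y v} → v ≢ x → v ≢ y → swapV x y v ≡ v
swapV-other v≢x v≢y rewrite ≡ᵇ-false v≢x | ≡ᵇ-false v≢y = refl

swapV-involutive : ∀ x y v → swapV x y (swapV x y v) ≡ v
swapV-involutive x y v with v ≟ x | v ≟ y
... | yes refl | _ = trans (cong (swapV v y) (swapV-left v y)) (swapV-right v y)
... | no _ | yes refl = trans (cong (swapV x v) (swapV-right x v)) (swapV-left x v)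
... | no v≢x | no v≢y = trans (cong (swapV x y) (swapV-other v≢x v≢y)) (swapV-other v≢x v≢y)

cyc3-1 : ∀ x y z → cyc3 x y z x ≡ y
cyc3-1 x y z rewrite ≡ᵇ-true {x} refl = refl

cyc3-2 : ∀ {x y} z → x ≢ y → cyc3 x y z y ≡ z
cyc3-2 {x} {y} z x≢y rewrite ≡ᵇ-false (≢-sym x≢y) | ≡ᵇ-true {y} refl = refl

cyc3-3 : ∀ {x y z} → x ≢ z → y ≢ z → cyc3 x y z z ≡ x
cyc3-3 {x} {y} {z} x≢z y≢z rewrite ≡ᵇ-false (≢-sym x≢z) | ≡ᵇ-false (≢-sym y≢z) | ≡ᵇ-true {z} refl = refl

cyc3-other : ∀ {x y z v} → v ≢ x → v ≢ y → v ≢ z → cyc3 x y z v ≡ v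
cyc3-other a b c rewrite ≡ᵇ-false a | ≡ᵇ-false b | ≡ᵇ-false c = refl

cyc3-inverse : ∀ {x y z} → x ≢ y → x ≢ z → y ≢ z → ∀ v → cyc3 z y x (cyc3 x y z v) ≡ v
cyc3-inverse {x} {y} {z} xy xz yz v with v ≟ x | v ≟ y | v ≟ z
... | yes refl | _ | _ = trans (cong (cyc3 z y x) (cyc3-1 x y z)) (cyc3-2 x (≢-sym yz))
... | no _ | yes refl | _ = trans (cong (cyc3 z y x) (cyc3-2 z xy)) (cyc3-1 z y x)
... | no _ | no _ | yes refl = trans (cong (cyc3 z y x) (cyc3-3 xz yz)) (cyc3-3 (≢-sym xz) (≢-sym xy))
... | no a | no b | no c = trans (cong (cyc3 z y x) (cyc3-other a b c)) (cyc3-other c b a)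

≡ᵇ-inverse : ∀ (f g : ℕ → ℕ) → (∀ x → g (f x) ≡ x) → (∀ x → f (g x) ≡ x) →
  ∀ v x → (f x ≡ᵇ v) ≡ (x ≡ᵇ g v)
≡ᵇ-inverse f g gf fg v x with f x ≟ v
... | yes refl = trans (≡ᵇ-true {f x} refl) (sym (≡ᵇ-true (sym (gf x))))
... | no ne = trans (≡ᵇ-false ne) (sym (≡ᵇ-false λ eq → ne (trans (cong f eq) (fg v))))

data Order3 (a b c : ℕ) : Set where
  abc : a < b → b < c → Order3 a b c
  cba : c < b → b < a → Order3 a b c
  bac : b < a → a < c → Order3 a b c
  cab : c < a → a < b → Order3 a b c
  acb : a < c → c < b → Order3 a b c
  bca : b < c → c < a → Order3 a b c

order3 : ∀ {a b c} → a ≢ b → a ≢ c → b ≢ c → Order3 a b c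
order3 {a} {b} {c} ab ac bc with <-cmp a b | <-cmp a c | <-cmp b c
... | tri≈ _ e _ | _ | _ = ⊥-elim (ab e)
... | _ | tri≈ _ e _ | _ = ⊥-elim (ac e)
... | _ | _ | tri≈ _ e _ = ⊥-elim (bc e)
... | tri< x _ _ | _ | tri< y _ _ = abc x y
... | tri> _ _ x | _ | tri> _ _ y = cba y x
... | tri< _ _ _ | tri< x _ _ | tri> _ _ y = acb x y
... | tri< x _ _ | tri> _ _ y | _ = cab y x
... | tri> _ _ x | tri< y _ _ | _ = bac x y
... | tri> _ _ _ | tri> _ _ x | tri< y _ _ = bca y x

btw-< : ∀ {x y z} → x < y → y < z → btw x y z ≡ true
btw-< p q rewrite <ᵇ-true p | <ᵇ-true q = refl

btw-> : ∀ {x y z} → z < y → y < x → btw x y z ≡ true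
btw-> p q rewrite <ᵇ-true p | <ᵇ-true q | <ᵇ-false (<⇒≤ q) = refl

btw-min : ∀ {x y z} → y < x → y < z → btw x y z ≡ false
btw-min p q rewrite <ᵇ-false (<⇒≤ p) | <ᵇ-false (<⇒≤ q) = refl

btw-max : ∀ {x y z} → x < y → z < y → btw x y z ≡ false
btw-max p q rewrite <ᵇ-true p | <ᵇ-false (<⇒≤ q) | <ᵇ-true q | <ᵇ-false (<⇒≤ p) = refl

module Local {n : ℕ} {w : List ℕ} (pw : IsPerm n w) {h : ℕ} (1≤h : 1 ≤ h) (h≤ : 2 + h ≤ n) where

  a b c : ℕ
  a = pos h w
  b = pos (1 + h) w
  c = pos (2 + h) w

  private
    h≤n : h ≤ n
    h≤n = ≤-trans (m≤n+m h 2) h≤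

  order : Order3 a b c
  order = order3
    (λ e → <⇒≢ (n<1+n h) (Perm.injective pw 1≤h h≤n (s≤s z≤n) (<⇒≤ h≤) e))
    (λ e → <⇒≢ (m≤n+m (suc h) 1) (Perm.injective pw 1≤h h≤n (s≤s z≤n) h≤ e))
    (λ e → <⇒≢ (n<1+n (suc h)) (Perm.injective pw (s≤s z≤n) (<⇒≤ h≤) (s≤s z≤n) h≤ e))

  Near : ℕ → Set
  Near v = (v ≡ h) ⊎ (v ≡ 1 + h) ⊎ (v ≡ 2 + h)

  near-bounds : ∀ {v} → Near v → 1 ≤ v × v ≤ n
  near-bounds (inj₁ refl) = 1≤h , h≤n
  near-bounds (inj₂ (inj₁ refl)) = s≤s z≤n , <⇒≤ h≤
  near-bounds (inj₂ (inj₂ refl)) = s≤s z≤n , h≤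

  swap-effect : ∀ {x y} → Near x → Near y →
    IsPerm n (map (swapV x y) w) × (∀ v → pos v (map (swapV x y) w) ≡ pos (swapV x y v) w)
  swap-effect {x} {y} nx ny =
    perm-map f f (swapV-involutive x y) (swapV-involutive x y) range range pw ,
    λ v → pos-map f (≡ᵇ-inverse f f (swapV-involutive x y) (swapV-involutive x y) v) w
    where
    f = swapV x y
    range : ∀ {v} → 1 ≤ v → v ≤ n → 1 ≤ f v × f v ≤ n
    range {v} l u with v ≟ x | v ≟ y
    ... | yes refl | _ = subst (λ z → 1 ≤ z × z ≤ n) (sym (swapV-left v y)) (near-bounds ny)
    ... | no _ | yes refl = subst (λ z → 1 ≤ z × z ≤ n) (sym (swapV-right x v)) (near-bounds nx)
    ... | no vx | no vy = subst (λ z → 1 ≤ z × z ≤ n) (sym (swapV-other vx vy)) (l , u)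

  cyc-effect : ∀ {x y z} → Near x → Near y → Near z → x ≢ y → x ≢ z → y ≢ z →
    IsPerm n (map (cyc3 x y z) w) × (∀ v → pos v (map (cyc3 x y z) w) ≡ pos (cyc3 z y x v) w)
  cyc-effect {x} {y} {z} nx ny nz xy xz yz =
    perm-map f g gf fg (range nx ny nz xy xz yz) (range nz ny nx (≢-sym yz) (≢-sym xz) (≢-sym xy)) pw ,
    λ v → pos-map f (≡ᵇ-inverse f g gf fg v) w
    where
    f = cyc3 x y z
    g = cyc3 z y x
    gf : ∀ v → g (f v) ≡ v
    gf = cyc3-inverse xy xz yz
    fg : ∀ v → f (g v) ≡ v
    fg = cyc3-inverse (≢-sym yz) (≢-sym xz) (≢-sym xy)
    range : ∀ {x y z} → Near x → Near y → Near z → x ≢ y → x ≢ z → y ≢ z →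
      ∀ {v} → 1 ≤ v → v ≤ n → 1 ≤ cyc3 x y z v × cyc3 x y z v ≤ n
    range {x} {y} {z} nx ny nz xy xz yz {v} l u with v ≟ x | v ≟ y | v ≟ z
    ... | yes refl | _ | _ = subst (λ z → 1 ≤ z × z ≤ n) (sym (cyc3-1 v y z)) (near-bounds ny)
    ... | no _ | yes refl | _ = subst (λ z → 1 ≤ z × z ≤ n) (sym (cyc3-2 z xy)) (near-bounds nz)
    ... | no _ | no _ | yes refl = subst (λ z → 1 ≤ z × z ≤ n) (sym (cyc3-3 xz yz)) (near-bounds nx)
    ... | no vx | no vy | no vz = subst (λ z → 1 ≤ z × z ≤ n) (sym (cyc3-other vx vy vz)) (l , u)

  h≢1+h : h ≢ 1 + h
  h≢1+h = <⇒≢ (n<1+n h)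
  h≢2+h : h ≢ 2 + h
  h≢2+h = <⇒≢ (m≤n+m (suc h) 1)
  1+h≢2+h : 1 + h ≢ 2 + h
  1+h≢2+h = <⇒≢ (n<1+n (suc h))

  near₀ : Near h
  near₀ = inj₁ refl
  near₁ : Near (1 + h)
  near₁ = inj₂ (inj₁ refl)
  near₂ : Near (2 + h)
  near₂ = inj₂ (inj₂ refl)

  p : ℕ → ℕ
  p v = pos v w

  -- Quantifying over all intervals containing the three positions, and below over all pairs of
  -- them, reaches the extreme pair whatever the order of `a`, `b`, `c`.
  NotPistoled : (ℕ → ℕ → Set) → Set
  NotPistoled R = ∀ {x y} → x ≤ a → a ≤ y → x ≤ b → b ≤ y → x ≤ c → c ≤ y → ¬ R x y

  AllPistoled : (ℕ → ℕ → Set) → Set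
  AllPistoled R = ∀ {x y} → x ∈ a ∷ b ∷ c ∷ [] → y ∈ a ∷ b ∷ c ∷ [] → R x y

  Moved : (ℕ → ℕ → Set) → List ℕ → Set
  Moved R w' = IsPerm n w' × Move R h p (λ v → pos v w')

  -- Relabelling a word by `f` puts the value `v` where the value `g v` was, for `g` inverse to `f`;
  -- the effect of a move on positions is thus read off `g`.
  moved : ∀ {R a' b' c'} (f g : ℕ → ℕ) →
    IsPerm n (map f w) × (∀ v → pos v (map f w) ≡ pos (g v) w) →
    pos (g h) w ≡ a' → pos (g (1 + h)) w ≡ b' → pos (g (2 + h)) w ≡ c' →
    (∀ {v} → v ≢ h → v ≢ 1 + h → v ≢ 2 + h → g v ≡ v) →
    Tri R a b c a' b' c' → Moved R (map f w)
  moved {R} f g (pf , eq) refl refl refl other t = pf , record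
    { tri = subst₂ (λ x y → Tri R a b c x y _) (sym (eq _)) (sym (eq _))
              (subst (Tri R a b c _ _) (sym (eq _)) t)
    ; frame = λ v v₀ v₁ v₂ → trans (eq v) (cong (λ x → pos x w) (other v₀ v₁ v₂)) }

  swap₁₂ : ∀ {R} → Tri R a b c a c b → Moved R (map (swapV (1 + h) (2 + h)) w)
  swap₁₂ = moved (swapV (1 + h) (2 + h)) _ (swap-effect near₁ near₂)
    (cong (λ x → pos x w) (swapV-other h≢1+h h≢2+h))
    (cong (λ x → pos x w) (swapV-left (1 + h) (2 + h)))
    (cong (λ x → pos x w) (swapV-right (1 + h) (2 + h)))
    (λ _ v₁ v₂ → swapV-other v₁ v₂)

  swap₁₀ : ∀ {R} → Tri R a b c b a c → Moved R (map (swapV (1 + h) h) w)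
  swap₁₀ = moved (swapV (1 + h) h) _ (swap-effect near₁ near₀)
    (cong (λ x → pos x w) (swapV-right (1 + h) h))
    (cong (λ x → pos x w) (swapV-left (1 + h) h))
    (cong (λ x → pos x w) (swapV-other (≢-sym 1+h≢2+h) (≢-sym h≢2+h)))
    (λ v₀ v₁ _ → swapV-other v₁ v₀)

  -- `R` is left free so that the same computation serves tableaux, where nothing is pistoled, and
  -- permutations whose three positions are not pistoled.
  d-effect : (Mid p h × d (suc h) w ≡ w)
           ⊎ (∀ R → NotPistoled R → Moved R (d (suc h) w))
  d-effect with order
  ... | abc x y rewrite btw-< x y = inj₁ (inj₁ (x , y) , refl)
  ... | cba x y rewrite btw-> x y = inj₁ (inj₂ (x , y) , refl)
  ... | bac x y rewrite btw-min x (<-trans x y) | btw-< x y = inj₂ λ R n → swap₁₂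
        (bac x y (n (<⇒≤ x) (<⇒≤ y) ≤-refl (<⇒≤ (<-trans x y)) (<⇒≤ (<-trans x y)) ≤-refl))
  ... | cab x y rewrite btw-max y (<-trans x y) | btw-> x y = inj₂ λ R n → swap₁₂
        (cab x y (n (<⇒≤ x) (<⇒≤ y) (<⇒≤ (<-trans x y)) ≤-refl ≤-refl (<⇒≤ (<-trans x y))))
  ... | acb x y rewrite btw-max (<-trans x y) y | btw-min (<-trans x y) x = inj₂ λ R n → swap₁₀
        (acb x y (n ≤-refl (<⇒≤ (<-trans x y)) (<⇒≤ (<-trans x y)) ≤-refl (<⇒≤ x) (<⇒≤ y)))
  ... | bca x y rewrite btw-min (<-trans x y) x | btw-max (<-trans x y) y = inj₂ λ R n → swap₁₀
        (bca x y (n (<⇒≤ (<-trans x y)) ≤-refl ≤-refl (<⇒≤ (<-trans x y)) (<⇒≤ x) (<⇒≤ y)))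

  cyc : ∀ {R x y z a' b' c'} → Near x → Near y → Near z → x ≢ y → x ≢ z → y ≢ z →
    pos (cyc3 z y x h) w ≡ a' → pos (cyc3 z y x (1 + h)) w ≡ b' → pos (cyc3 z y x (2 + h)) w ≡ c' →
    (∀ {v} → v ≢ h → v ≢ 1 + h → v ≢ 2 + h → cyc3 z y x v ≡ v) →
    Tri R a b c a' b' c' → Moved R (map (cyc3 x y z) w)
  cyc {x = x} {y} {z} nx ny nz xy xz yz = moved (cyc3 x y z) _ (cyc-effect nx ny nz xy xz yz)

  dt-effect : (Mid p h × dt (suc h) w ≡ w)
            ⊎ (∀ R → AllPistoled R → Moved R (dt (suc h) w))
  dt-effect with order
  ... | abc x y rewrite btw-< x y = inj₁ (inj₁ (x , y) , refl)
  ... | cba x y rewrite btw-> x y = inj₁ (inj₂ (x , y) , refl)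
  ... | bac x y rewrite btw-min x (<-trans x y) | <ᵇ-true x | <ᵇ-true y | <ᵇ-true (<-trans x y) =
        inj₂ λ R r → cyc near₁ near₀ near₂ (≢-sym h≢1+h) 1+h≢2+h h≢2+h
          (cong (λ x → pos x w) (cyc3-2 (1 + h) (≢-sym h≢2+h)))
          (cong (λ x → pos x w) (cyc3-3 (≢-sym 1+h≢2+h) h≢1+h))
          (cong (λ x → pos x w) (cyc3-1 (2 + h) h (1 + h)))
          (λ v₀ v₁ v₂ → cyc3-other v₂ v₀ v₁)
          (bac~ x y (r (there (here refl)) (there (there (here refl)))))
  ... | bca x y rewrite btw-min (<-trans x y) x | <ᵇ-true x | <ᵇ-false (<⇒≤ y) | <ᵇ-true (<-trans x y) =
        inj₂ λ R r → cyc near₁ near₂ near₀ 1+h≢2+h (≢-sym h≢1+h) (≢-sym h≢2+h)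
          (cong (λ x → pos x w) (cyc3-1 h (2 + h) (1 + h)))
          (cong (λ x → pos x w) (cyc3-3 h≢1+h (≢-sym 1+h≢2+h)))
          (cong (λ x → pos x w) (cyc3-2 (1 + h) h≢2+h))
          (λ v₀ v₁ v₂ → cyc3-other v₀ v₂ v₁)
          (bca~ x y (r (there (here refl)) (here refl)))
  ... | acb x y rewrite btw-max (<-trans x y) y | <ᵇ-true x | <ᵇ-false (<⇒≤ (<-trans x y)) =
        inj₂ λ R r → cyc near₀ near₁ near₂ h≢1+h h≢2+h 1+h≢2+h
          (cong (λ x → pos x w) (cyc3-3 (≢-sym h≢2+h) (≢-sym h≢1+h)))
          (cong (λ x → pos x w) (cyc3-2 h (≢-sym 1+h≢2+h)))
          (cong (λ x → pos x w) (cyc3-1 (2 + h) (1 + h) h))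
          (λ v₀ v₁ v₂ → cyc3-other v₂ v₁ v₀)
          (acb~ x y (r (here refl) (there (here refl))))
  ... | cab x y rewrite btw-max y (<-trans x y) | <ᵇ-false (<⇒≤ x) | <ᵇ-false (<⇒≤ y) =
        inj₂ λ R r → cyc near₂ near₁ near₀ (≢-sym 1+h≢2+h) (≢-sym h≢2+h) (≢-sym h≢1+h)
          (cong (λ x → pos x w) (cyc3-1 h (1 + h) (2 + h)))
          (cong (λ x → pos x w) (cyc3-2 (2 + h) h≢1+h))
          (cong (λ x → pos x w) (cyc3-3 h≢2+h 1+h≢2+h))
          (λ v₀ v₁ v₂ → cyc3-other v₀ v₁ v₂)
          (cab~ x y (r (there (there (here refl))) (there (here refl))))

-- The value i always changes place, which gives the distinct endpoints required of an edge.
tri-moves : ∀ {R a b c a' b' c'} → Tri R a b c a' b' c' → b ≢ b'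
tri-moves (bac p q _)  = <⇒≢ (<-trans p q)
tri-moves (cab p q _)  = >⇒≢ (<-trans p q)
tri-moves (acb p q _)  = >⇒≢ (<-trans p q)
tri-moves (bca p q _)  = <⇒≢ (<-trans p q)
tri-moves (bac~ p q _) = <⇒≢ (<-trans p q)
tri-moves (cab~ p q _) = >⇒≢ (<-trans p q)
tri-moves (acb~ p q _) = >⇒≢ (<-trans p q)
tri-moves (bca~ p q _) = <⇒≢ (<-trans p q)

move-sym : ∀ {R h q q'} → (∀ {x y} → ¬ R x y) → Move R h q q' → Move R h q' q
move-sym n s = record
  { tri = tri-sym n (Move.tri s) ; frame = λ v v₀ v₁ v₂ → sym (Move.frame s v v₀ v₁ v₂) }

-- Pistols

≺-trans : ∀ {c d e} → c ≺ d → d ≺ e → c ≺ e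
≺-trans (inj₁ p) (inj₁ q) = inj₁ (ℤ.<-trans q p)
≺-trans (inj₁ p) (inj₂ (refl , _)) = inj₁ p
≺-trans (inj₂ (refl , _)) (inj₁ q) = inj₁ q
≺-trans (inj₂ (refl , p)) (inj₂ (refl , q)) = inj₂ (refl , ℤ.<-trans p q)

_≼_ : Cell → Cell → Set
c ≼ d = c ≡ d ⊎ c ≺ d

nth-AllPairs : ∀ {A : Set} {_~_ : A → A → Set} {xs x y i j} → AllPairs _~_ xs →
  Nth x xs i → Nth y xs j → i < j → x ~ y
nth-AllPairs (p ∷ _) here (there j) _ = All.lookup p (nth-∈ j)
nth-AllPairs (_ ∷ ps) (there i) (there j) (s≤s lt) = nth-AllPairs ps i j lt

nth-≼ : ∀ {δ c d i j} → Diagram δ → Nth c δ i → Nth d δ j → i ≤ j → c ≼ d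
nth-≼ D ci dj i≤j with m≤n⇒m<n∨m≡n i≤j
... | inj₁ i<j = inj₂ (nth-AllPairs (Linked⇒AllPairs (λ {c} {d} {e} → ≺-trans {c} {d} {e}) D) ci dj i<j)
... | inj₂ refl = inj₁ (nth-functional ci dj)

-- A pistol is an interval in row reading order.
pistol-convex : ∀ {c d e f} → InPistol c d → InPistol c f → d ≼ e → e ≼ f → InPistol c e
pistol-convex p q (inj₁ refl) _ = p
pistol-convex p q _ (inj₁ refl) = q
pistol-convex {x , y} (inj₁ (refl , p)) (inj₁ (refl , q)) (inj₂ (inj₂ (refl , r))) (inj₂ _) =
  inj₁ (refl , ℤ.≤-trans p (ℤ.<⇒≤ r))
pistol-convex {x , y} (inj₁ (refl , p)) (inj₁ (refl , q)) (inj₂ (inj₁ r)) (inj₂ (inj₁ s)) =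
  ⊥-elim (ℤ.<-asym r s)
pistol-convex {x , y} (inj₁ (refl , p)) (inj₁ (refl , q)) (inj₂ (inj₁ r)) (inj₂ (inj₂ (refl , s))) =
  ⊥-elim (ℤ.<-irrefl refl r)
pistol-convex {x , y} (inj₁ (refl , p)) (inj₂ (refl , q)) (inj₂ (inj₂ (refl , r))) (inj₂ _) =
  inj₁ (refl , ℤ.≤-trans p (ℤ.<⇒≤ r))
pistol-convex {x , y} (inj₁ (refl , p)) (inj₂ (refl , q)) (inj₂ (inj₁ r)) (inj₂ (inj₂ (refl , s))) =
  inj₂ (refl , ℤ.≤-trans (ℤ.<⇒≤ s) q)
pistol-convex {x , y} {e = _ , z} (inj₁ (refl , p)) (inj₂ (refl , q)) (inj₂ (inj₁ r)) (inj₂ (inj₁ s)) =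
  ⊥-elim (ℤ.<-irrefl refl (ℤ.<-≤-trans s (≤-pred-ℤ r)))
  where
  ≤-pred-ℤ : z ℤ.< y → z ℤ.≤ y ℤ.- ℤ.1ℤ
  ≤-pred-ℤ lt = subst (z ℤ.≤_) (ℤ.+-comm ℤ.-1ℤ y) (ℤ.i<j⇒i≤pred[j] lt)
pistol-convex {x , y} (inj₂ (refl , p)) (inj₁ (refl , q)) de ef = ⊥-elim (row≰ (≼-row (≼-trans de ef)))
  where
  ≼-trans : ∀ {c d e} → c ≼ d → d ≼ e → c ≼ e
  ≼-trans (inj₁ refl) q = q
  ≼-trans p (inj₁ refl) = p
  ≼-trans {c} {d} {e} (inj₂ p) (inj₂ q) = inj₂ (≺-trans {c} {d} {e} p q)
  ≼-row : ∀ {c d} → c ≼ d → proj₂ d ℤ.≤ proj₂ c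
  ≼-row (inj₁ refl) = ℤ.≤-refl
  ≼-row (inj₂ (inj₁ p)) = ℤ.<⇒≤ p
  ≼-row (inj₂ (inj₂ (refl , _))) = ℤ.≤-refl
  row≰ : ¬ y ℤ.≤ y ℤ.- ℤ.1ℤ
  row≰ le = ℤ.<-irrefl refl (ℤ.i≤pred[j]⇒i<j (subst (y ℤ.≤_) (ℤ.+-comm y ℤ.-1ℤ) le))
pistol-convex {x , y} (inj₂ (refl , p)) (inj₂ (refl , q)) (inj₂ (inj₂ (refl , r))) (inj₂ (inj₂ (refl , s))) =
  inj₂ (refl , ℤ.≤-trans (ℤ.<⇒≤ s) q)
pistol-convex {x , y} (inj₂ (refl , p)) (inj₂ (refl , q)) (inj₂ (inj₂ (refl , r))) (inj₂ (inj₁ s)) =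
  ⊥-elim (ℤ.<-irrefl refl s)
pistol-convex {x , y} (inj₂ (refl , p)) (inj₂ (refl , q)) (inj₂ (inj₁ r)) (inj₂ (inj₁ s)) =
  ⊥-elim (ℤ.<-asym r s)
pistol-convex {x , y} (inj₂ (refl , p)) (inj₂ (refl , q)) (inj₂ (inj₁ r)) (inj₂ (inj₂ (refl , s))) =
  ⊥-elim (ℤ.<-irrefl refl r)

inPistol? : ∀ c d → Dec (InPistol c d)
inPistol? (x , y) (x' , y') =
  ((y' ℤ.≟ y) ×-dec (x ℤ.≤? x')) ⊎-dec ((y' ℤ.≟ y ℤ.- ℤ.1ℤ) ×-dec (x' ℤ.≤? x))

nth? : ∀ {A : Set} {P : A → Set} → (∀ x → Dec (P x)) → ∀ xs k → Dec (Σ A λ x → Nth x xs k × P x)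
nth? P? [] k = no λ ()
nth? P? (x ∷ xs) zero = map′ (λ p → x , here , p) (λ { (_ , here , p) → p }) (P? x)
nth? P? (x ∷ xs) (suc k) =
  map′ (λ { (y , i , p) → y , there i , p }) (λ { (y , there i , p) → y , i , p }) (nth? P? xs k)

-- The choice between `d` and `d̃` must be decided in order to produce a move. The search is finite
-- because pistols start at cells of δ.
pistoled? : ∀ δ ks → Dec (Pistoled δ (map suc ks))
pistoled? δ ks = map′ (λ a → find a) (λ { (c , c∈ , a) → lose c∈ a }) (any? (λ c → all-in c ks) δ)
  where
  all-in : ∀ c ks → Dec (All (λ p → Σ Cell λ d → At δ p d × InPistol c d) (map suc ks))
  all-in c [] = yes []
  all-in c (k ∷ ks) = map′ (λ { ((d , i , p) , as) → (d , nth⇒At i , p) ∷ as })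
    (λ { ((d , i , p) ∷ as) → (d , At⇒nth i , p) , as })
    (nth? (inPistol? c) δ k ×-dec all-in c ks)

PistoledPair : List Cell → ℕ → ℕ → Set
PistoledPair δ x y = Pistoled δ (suc x ∷ suc y ∷ [])

pistoled-hull : ∀ {δ x y zs} → Diagram δ → PistoledPair δ x y → All (λ z → x ≤ z × z ≤ y) zs →
  Pistoled δ (map suc zs)
pistoled-hull {δ} {x} {y} {zs} D (c , c∈ , (d , i , p) ∷ (f , j , q) ∷ []) within = c , c∈ , go within
  where
  i' = At⇒nth i
  j' = At⇒nth j
  go : ∀ {zs} → All (λ z → x ≤ z × z ≤ y) zs → All (λ p → Σ Cell λ d → At δ p d × InPistol c d) (map suc zs)
  go [] = []
  go ((x≤z , z≤y) ∷ rest) with <-nth (≤-<-trans z≤y (nth-< j'))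
  ... | e , k = (e , nth⇒At k , pistol-convex p q (nth-≼ D i' k x≤z) (nth-≼ D k j' z≤y)) ∷ go rest

pistoled-pair : ∀ {δ x y ps} → Pistoled δ ps → suc x ∈ ps → suc y ∈ ps → PistoledPair δ x y
pistoled-pair (c , c∈ , ps) x∈ y∈ = c , c∈ , All.lookup ps x∈ ∷ All.lookup ps y∈ ∷ []

pistoledPair-closed : ∀ {δ} → Diagram δ → IntervalClosed (PistoledPair δ)
pistoledPair-closed D x≤x' x'≤y' y'≤y r =
  pistoled-hull D r ((x≤x' , ≤-trans x'≤y' y'≤y) ∷ (≤-trans x≤x' x'≤y' , y'≤y) ∷ [])

assaf-move : ∀ {δ} → Diagram δ → ∀ {π} → IsPerm (length δ) π →
  ∀ {h} → 1 ≤ h → 2 + h ≤ length δ → ¬ Mid (λ v → pos v π) h →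
  Σ (List ℕ) λ π' → IsPerm (length δ) π' × E (Assaf δ) (suc h) π π' ×
    Move (PistoledPair δ) h (λ v → pos v π) (λ v → pos v π')
assaf-move {δ} D {π} pπ {h} 1≤h h≤ ¬mid with pistoled? δ (pos h π ∷ pos (1 + h) π ∷ pos (2 + h) π ∷ [])
... | yes pd = go dt-effect
  where
  open Local pπ 1≤h h≤
  P : AllPistoled (PistoledPair δ)
  P x∈ y∈ = pistoled-pair pd (∈-map⁺ suc x∈) (∈-map⁺ suc y∈)
  P3 : Pistoled3 δ (suc h) π
  P3 = _ , _ , _ , nth⇒At (Perm.nth pπ 1≤h (<⇒≤ (<⇒≤ h≤)))
     , nth⇒At (Perm.nth pπ (s≤s z≤n) (<⇒≤ h≤)) , nth⇒At (Perm.nth pπ (s≤s z≤n) h≤) , pd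
  go : _ ⊎ _ → _
  go (inj₁ (m , _)) = ⊥-elim (¬mid m)
  go (inj₂ f) with f (PistoledPair δ) P
  ... | perm , mv = _ , perm , inj₁ (inj₁ (P3 , refl) ,
        (λ eq → tri-moves (Move.tri mv) (cong (pos (suc h)) (sym eq)))) , mv
... | no ¬pd = go d-effect
  where
  open Local pπ 1≤h h≤
  N : NotPistoled (PistoledPair δ)
  N xa ay xb by xc cy r = ¬pd (pistoled-hull D r ((xa , ay) ∷ (xb , by) ∷ (xc , cy) ∷ []))
  N3 : ¬ Pistoled3 δ (suc h) π
  N3 (suc p , suc q , suc r , i , j , k , pd)
    rewrite pos-nth (Perm.unique pπ) (At⇒nth i) | pos-nth (Perm.unique pπ) (At⇒nth j)
          | pos-nth (Perm.unique pπ) (At⇒nth k) = ¬pd pd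
  go : _ ⊎ _ → _
  go (inj₁ (m , _)) = ⊥-elim (¬mid m)
  go (inj₂ f) with f (PistoledPair δ) N
  ... | perm , mv = _ , perm , inj₁ (inj₂ (N3 , refl) ,
        (λ eq → tri-moves (Move.tri mv) (cong (pos (suc h)) (sym eq)))) , mv

-- The bisimulation given by an isomorphism

concat-↭ : ∀ {A : Set} {xss yss : List (List A)} → xss ↭ yss → concat xss ↭ concat yss
concat-↭ ↭.refl = ↭-refl
concat-↭ (↭.prep xs p) = ++⁺ˡ xs (concat-↭ p)
concat-↭ (↭.swap {xss} {yss} xs ys p) = ↭-trans
  (↭-trans (↭-reflexive (sym (++-assoc xs ys (concat xss))))
    (++⁺ʳ (concat xss) (++-comm xs ys)))
  (↭-trans (↭-reflexive (++-assoc ys xs (concat xss))) (++⁺ˡ ys (++⁺ˡ xs (concat-↭ p))))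
concat-↭ (↭.trans p q) = ↭-trans (concat-↭ p) (concat-↭ q)

rw-perm : ∀ {μ t} → SYT μ t → IsPerm (sum μ) (rw t)
rw-perm {t = t} (_ , p , _) = ↭-trans (concat-↭ (↭-reverse t)) p

++-injective : ∀ {A : Set} (xs ys : List A) {xs' ys'} → length xs ≡ length ys →
  xs ++ xs' ≡ ys ++ ys' → xs ≡ ys × xs' ≡ ys'
++-injective [] [] _ eq = refl , eq
++-injective (x ∷ xs) (y ∷ ys) len eq =
  let e , e' = ++-injective xs ys (suc-injective len) (∷-injectiveʳ eq)
  in cong₂ _∷_ (∷-injectiveˡ eq) e , e'

concat-injective : ∀ {A : Set} (xss yss : List (List A)) → map length xss ≡ map length yss →
  concat xss ≡ concat yss → xss ≡ yss
concat-injective [] [] _ _ = refl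
concat-injective (xs ∷ xss) (ys ∷ yss) len eq =
  let e , e' = ++-injective xs ys (∷-injectiveˡ len) eq
  in cong₂ _∷_ e (concat-injective xss yss (∷-injectiveʳ len) e')

rw-injective : ∀ {t t'} → map length t ≡ map length t' → rw t ≡ rw t' → t ≡ t'
rw-injective {t} {t'} len eq = reverse-injective (concat-injective (reverse t) (reverse t')
  (trans (reverse-map length t) (trans (cong reverse len) (sym (reverse-map length t')))) eq)

-- Edges are unordered, so `t` may be the image of `t'`; `d` is its own inverse, which is
-- `move-sym`.
std-move : ∀ {n t t'} → IsPerm n (rw t) → IsPerm n (rw t') → ∀ {h} → 1 ≤ h → 2 + h ≤ n →
  E StdGraph (suc h) t t' → Move (λ _ _ → ⊥) h (λ v → pos v (rw t)) (λ v → pos v (rw t'))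
std-move {n} pt pt' {h} 1≤h h≤ (inj₁ (eq , ne)) with Local.d-effect pt 1≤h h≤
... | inj₁ (_ , fix) = ⊥-elim (ne (trans eq fix))
... | inj₂ f = subst (λ w → Move _ h _ (λ v → pos v w)) (sym eq) (proj₂ (f _ (λ _ _ _ _ _ _ ())))
std-move {n} pt pt' {h} 1≤h h≤ (inj₂ (eq , ne)) with Local.d-effect pt' 1≤h h≤
... | inj₁ (_ , fix) = ⊥-elim (ne (trans eq fix))
... | inj₂ f = move-sym (λ ())
      (subst (λ w → Move _ h _ (λ v → pos v w)) (sym eq) (proj₂ (f _ (λ _ _ _ _ _ _ ()))))

module FromIso {δ : List Cell} (D : Diagram δ) {μ : List ℕ} (|μ| : sum μ ≡ length δ) {v0 : List ℕ}
    (iso : Iso (length δ) (Assaf δ) (Comp (Assaf δ) (IsPerm (length δ)) (length δ) v0)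
               StdGraph (SYT μ)) where

  open Iso iso

  n = length δ
  C = Comp (Assaf δ) (IsPerm n) n v0

  Matched : (ℕ → ℕ) → (ℕ → ℕ) → Set
  Matched q p = Σ (List (List ℕ)) λ T → SYT μ T × (q ≡ λ v → pos v (rw T)) × (p ≡ λ v → pos v (g T))

  perm-T : ∀ {T} → SYT μ T → IsPerm n (rw T)
  perm-T {T} s = subst (λ m → IsPerm m (rw T)) |μ| (rw-perm s)

  sig⇒ : ∀ w w' → (∀ i → 1 ≤ i → i < n → sigW w i ≡ sigW w' i) →
    ∀ {v} → 1 ≤ v → v < n → pos v w < pos (suc v) w → pos v w' < pos (suc v) w'
  sig⇒ _ _ eq 1≤v v<n lt = <ᵇ-true⁻ (trans (sym (eq _ 1≤v v<n)) (<ᵇ-true lt))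

  apart : ∀ {w} → IsPerm n w → ∀ {v} → 1 ≤ v → v < n → pos v w ≢ pos (suc v) w
  apart pw 1≤v v<n e = 1+n≢n (sym (Perm.injective pw 1≤v (<⇒≤ v<n) (s≤s z≤n) v<n e))

  bisim : Bisim n (λ _ _ → ⊥) (PistoledPair δ) Matched
  bisim = record
    { injˡ = λ { (T , s , refl , refl) → Perm.injective (perm-T s) }
    ; injʳ = λ { (T , s , refl , refl) → Perm.injective (proj₁ (into T s)) }
    ; sigʳ = λ { (T , s , refl , refl) → sig⇒ (rw T) (g T) (λ i a b → sym (sigPres T s i a b)) }
    ; sigˡ = λ { (T , s , refl , refl) → sig⇒ (g T) (rw T) (sigPres T s) }
    ; step = λ { (T , s , refl , refl) → step T s }
    ; detʳ = λ { (T , s , refl , refl) (T' , s' , refl , refl) eq v → cong (λ T → pos v (g T))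
        (rw-injective {T} {T'} (trans (proj₁ s) (sym (proj₁ s'))) (perm-ext (perm-T s) (perm-T s') eq)) }
    ; detˡ = λ { (T , s , refl , refl) (T' , s' , refl , refl) eq v → cong (λ T → pos v (rw T))
        (inj T T' s s' (perm-ext (proj₁ (into T s)) (proj₁ (into T' s')) eq)) }
    }
    where
    -- The move is made on the permutation `g T` and pulled back: its edge stays in the component,
    -- `surj` supplies the tableau reached, and `edgePres` makes the pair an edge of tableaux.
    step : ∀ T → SYT μ T → ∀ {h} → 1 ≤ h → 2 + h ≤ n → ¬ Mid (λ v → pos v (rw T)) h →
      Σ (ℕ → ℕ) λ q' → Σ (ℕ → ℕ) λ p' → Matched q' p' ×
        Move (λ _ _ → ⊥) h (λ v → pos v (rw T)) q' × Move (PistoledPair δ) h (λ v → pos v (g T)) p'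
    step T s {h} 1≤h h≤ ¬mid
      with assaf-move D (proj₁ (into T s)) 1≤h h≤
        (λ m → ¬mid (mid-transfer (λ v → pos v (rw T)) (λ v → pos v (g T))
          (sig⇒ (g T) (rw T) (sigPres T s)) (sig⇒ (rw T) (g T) (λ i a b → sym (sigPres T s i a b))) (apart (perm-T s)) 1≤h h≤ m))
    ... | π' , perm' , edge , mv
      with surj π' (perm' , proj₂ (into T s) ◅◅ ((proj₁ (into T s) , perm' , suc h , s≤s 1≤h , h≤ , edge) ◅ ε))
    ... | T' , s' , refl = _ , _ , (T' , s' , refl , refl) ,
      std-move {t = T} {T'} (perm-T s) (perm-T s') 1≤h h≤
        (Equivalence.to (edgePres T T' s s' (suc h) (s≤s 1≤h) h≤) edge) , mv

-- Yamanouchi fillings of arbitrary weight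

-- The i-th block (i ≥ 0) of μ consists of the part μ (i + 1) values following off μ o i.
off : List ℕ → ℕ → ℕ → ℕ
off μ o zero = o
off [] o (suc i) = o
off (m ∷ μ) o (suc i) = off μ (o + m) i

off-suc : ∀ μ o i → off μ o (suc i) ≡ off μ o i + part μ (suc i)
off-suc [] o zero = sym (+-identityʳ o)
off-suc [] o (suc i) = sym (+-identityʳ o)
off-suc (m ∷ μ) o zero = refl
off-suc (m ∷ μ) o (suc i) = off-suc μ (o + m) i

off-≤ : ∀ μ o i → off μ o i ≤ o + sum μ
off-≤ [] o zero = m≤m+n o 0
off-≤ [] o (suc i) = m≤m+n o 0
off-≤ (m ∷ μ) o zero = m≤m+n o _
off-≤ (m ∷ μ) o (suc i) = ≤-trans (off-≤ μ (o + m) i) (≤-reflexive (+-assoc o m (sum μ)))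

off-≥ : ∀ μ o i → o ≤ off μ o i
off-≥ μ o zero = ≤-refl
off-≥ [] o (suc i) = ≤-refl
off-≥ (m ∷ μ) o (suc i) = ≤-trans (m≤m+n o m) (off-≥ μ (o + m) i)

block-≤ : ∀ μ o i → off μ o i + part μ (suc i) ≤ o + sum μ
block-≤ μ o i = ≤-trans (≤-reflexive (sym (off-suc μ o i))) (off-≤ μ o (suc i))

off-length : ∀ μ o → off μ o (length μ) ≡ o + sum μ
off-length [] o = sym (+-identityʳ o)
off-length (m ∷ μ) o = trans (off-length μ (o + m)) (+-assoc o m (sum μ))

part-≥length : ∀ μ i → length μ ≤ i → part μ (suc i) ≡ 0
part-≥length [] i _ = refl
part-≥length (m ∷ μ) (suc i) (s≤s le) = part-≥length μ i le

InBlock : List ℕ → ℕ → ℕ → ℕ → Set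
InBlock μ o i v = off μ o i < v × v ≤ off μ o i + part μ (suc i)

locate : ∀ μ o v → o < v → v ≤ o + sum μ → ∃ λ i → InBlock μ o i v
locate [] o v o<v v≤ rewrite +-identityʳ o = 0 , o<v , ≤-trans v≤ (m≤m+n o 0)
locate (m ∷ μ) o v o<v v≤ with v ≤? o + m
... | yes v≤m = 0 , o<v , v≤m
... | no v≰m with locate μ (o + m) v (≰⇒> v≰m) (≤-trans v≤ (≤-reflexive (sym (+-assoc o m (sum μ)))))
... | i , x = suc i , x

partition-tail : ∀ {m μ} → IsPartition (m ∷ μ) → IsPartition μ
partition-tail {μ = []} (_ ∷ a , _) = [] , []
partition-tail {μ = _ ∷ _} (_ ∷ a , _ ∷ l) = a , l

part-antitone : ∀ {μ} → IsPartition μ → ∀ i → part μ (2 + i) ≤ part μ (suc i)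
part-antitone {[]} _ i = z≤n
part-antitone {m ∷ []} _ zero = z≤n
part-antitone {m ∷ k ∷ μ} (_ , le ∷ _) zero = le
part-antitone {m ∷ μ} pμ (suc i) = part-antitone (partition-tail pμ) i

-- The position function p of a filling is that of a non-jamming standardized Yamanouchi word
-- of weight μ. It suffices to compare the i-th block with the end of the preceding one, where
-- l + 1, l + 2, … are the last values of the preceding block.
record Good (R : ℕ → ℕ → Set) (μ : List ℕ) (o : ℕ) (p : ℕ → ℕ) : Set where
  field
    asc : ∀ i v → off μ o i < v → v < off μ o i + part μ (suc i) → p v < p (suc v)
    yam : ∀ i l → l + part μ (2 + i) ≡ off μ o i + part μ (suc i) →
          Yamanouchi R (part μ (2 + i)) (λ j → p (j + suc l)) (λ j → p (j + (part μ (2 + i) + suc l)))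

yam-bound : ∀ μ o i l → l + part μ (2 + i) ≡ off μ o i + part μ (suc i) →
  part μ (2 + i) + (part μ (2 + i) + suc l) ≤ suc (o + sum μ)
yam-bound μ o i l eq = begin
  k + (k + suc l)             ≡⟨ cong (k +_) (+-suc k l) ⟩
  k + suc (k + l)             ≡⟨ +-suc k (k + l) ⟩
  suc (k + (k + l))           ≡⟨ cong suc (+-comm k (k + l)) ⟩
  suc ((k + l) + k)           ≡⟨ cong (λ x → suc (x + k)) (trans (+-comm k l) (trans eq (sym (off-suc μ o i)))) ⟩
  suc (off μ o (suc i) + k)   ≤⟨ s≤s (block-≤ μ o (suc i)) ⟩
  suc (o + sum μ)             ∎
  where
  open ≤-Reasoning
  k = part μ (2 + i)

-- Ascents inside a block are signature data; each pair of neighbouring blocks is an instance of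
-- `transfer`.
good-transfer : ∀ {n R R' S} → Bisim n R R' S → IntervalClosed R → IntervalClosed R' →
  ∀ {μ q p} → sum μ ≡ n → S q p → Good R μ 0 q → Good R' μ 0 p
good-transfer B c c' {μ} refl s γ = record
  { asc = λ i v lo hi → Bisim.sigʳ B s (≤-trans (s≤s z≤n) lo) (<-≤-trans hi (block-≤ μ 0 i)) (Good.asc γ i v lo hi)
  ; yam = λ i l eq → Transfer.transfer B c c' (part μ (2 + i)) refl (s≤s z≤n) (yam-bound μ 0 i l eq) s
      (occupies λ _ _ → refl) (occupies λ _ _ → refl) (occupies λ _ _ → refl) (occupies λ _ _ → refl)
      (Good.yam γ i l eq) }

yamanouchi-cong : ∀ {R k a b a' b'} → (∀ j → j < k → a j ≡ a' j) → (∀ j → j < k → b j ≡ b' j) →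
  Yamanouchi R k a b → Yamanouchi R k a' b'
yamanouchi-cong {R} ea eb y = record
  { asc-a = λ j lt → subst₂ _<_ (ea j (<⇒≤ lt)) (ea (suc j) lt) (Yamanouchi.asc-a y j lt)
  ; asc-b = λ j lt → subst₂ _<_ (eb j (<⇒≤ lt)) (eb (suc j) lt) (Yamanouchi.asc-b y j lt)
  ; b<a = λ j lt → subst₂ _<_ (eb j lt) (ea j lt) (Yamanouchi.b<a y j lt)
  ; no-jam = λ j lt r → Yamanouchi.no-jam y j lt (subst₂ R (sym (eb j (<⇒≤ lt))) (sym (ea (suc j) lt)) r) }

-- Only values of the blocks matter, so the condition survives adding or removing a bottom row of
-- smaller values.
good-cong : ∀ {R μ o p p'} → IsPartition μ → (∀ v → o < v → v ≤ o + sum μ → p v ≡ p' v) →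
  Good R μ o p → Good R μ o p'
good-cong {R} {μ} {o} {p} {p'} pμ eq γ = record
  { asc = λ i v lo hi → subst₂ _<_
      (eq v (≤-<-trans (off-≥ μ o i) lo) (≤-trans (<⇒≤ hi) (block-≤ μ o i)))
      (eq (suc v) (s≤s (≤-trans (off-≥ μ o i) (<⇒≤ lo))) (≤-trans hi (block-≤ μ o i)))
      (Good.asc γ i v lo hi)
  ; yam = λ i l e →
      let k = part μ (2 + i)
          o≤l : o ≤ l
          o≤l = +-cancelʳ-≤ k o l (≤-trans (+-mono-≤ (off-≥ μ o i) (part-antitone pμ i)) (≤-reflexive (sym e)))
          below : ∀ {x} → x < k + (k + suc l) → x ≤ o + sum μ
          below lt = ≤-pred (≤-trans lt (yam-bound μ o i l e))
      in yamanouchi-cong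
        (λ j j<k → eq (j + suc l) (≤-<-trans o≤l (m≤n+m (suc l) j))
          (below (<-≤-trans (+-monoˡ-< (suc l) j<k) (m≤n+m (k + suc l) k))))
        (λ j j<k → eq (j + (k + suc l)) (≤-<-trans o≤l (≤-trans (m≤n+m (suc l) k) (m≤n+m (k + suc l) j)))
          (below (+-monoˡ-< (k + suc l) j<k)))
        (Good.yam γ i l e) }

good-tail : ∀ {R m μ o p} → Good R (m ∷ μ) o p → Good R μ (o + m) p
good-tail γ = record { asc = λ i → Good.asc γ (suc i) ; yam = λ i → Good.yam γ (suc i) }

-- The compared rows both end at the ends of their blocks, so this is `b<a` at the last index.
last-precedes : ∀ {R μ o p} → IsPartition μ → Good R μ o p → ∀ i → 1 ≤ part μ (2 + i) →
  p (off μ o (suc i) + part μ (2 + i)) < p (off μ o i + part μ (suc i))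
last-precedes {R} {μ} {o} {p} pμ γ i 1≤k = go (part μ (2 + i)) refl 1≤k
  where
  go : ∀ k → k ≡ part μ (2 + i) → 1 ≤ k → p (off μ o (suc i) + k) < p (off μ o i + part μ (suc i))
  go (suc k) e _ = subst₂ (λ x y → p x < p y) eb ea
      (Yamanouchi.b<a (Good.yam γ i l l+) k (≤-reflexive e))
    where
    x = off μ o i + part μ (suc i)
    l = x ∸ part μ (2 + i)
    l+ : l + part μ (2 + i) ≡ x
    l+ = m∸n+n≡m (≤-trans (part-antitone pμ i) (m≤n+m _ (off μ o i)))
    ea : k + suc l ≡ x
    ea = trans (+-suc k l) (trans (cong (_+ l) e) (trans (+-comm _ l) l+))
    eb : k + (part μ (2 + i) + suc l) ≡ off μ o (suc i) + suc k
    eb = begin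
      k + (K + suc l)            ≡⟨ cong (k +_) (+-suc K l) ⟩
      k + suc (K + l)            ≡⟨ +-suc k (K + l) ⟩
      suc k + (K + l)            ≡⟨ +-comm (suc k) (K + l) ⟩
      (K + l) + suc k            ≡⟨ cong (_+ suc k) (trans (+-comm K l) (trans l+ (sym (off-suc μ o i)))) ⟩
      off μ o (suc i) + suc k    ∎
      where
      open ≡-Reasoning
      K = part μ (2 + i)

asc-≤ : ∀ {R μ o p} → Good R μ o p → ∀ i {u v} → off μ o i < u → u ≤ v →
  v ≤ off μ o i + part μ (suc i) → p u ≤ p v
asc-≤ γ i {u} {zero} lo z≤n hi = ≤-refl
asc-≤ γ i {u} {suc v} lo u≤v hi with m≤n⇒m<n∨m≡n u≤v
... | inj₂ refl = ≤-refl
... | inj₁ (s≤s u≤v') = ≤-trans (asc-≤ γ i lo u≤v' (<⇒≤ hi)) (<⇒≤ (Good.asc γ i v (<-≤-trans lo u≤v') hi))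

-- Superstandard tableaux

None : ℕ → ℕ → Set
None _ _ = ⊥

block : ℕ → ℕ → List ℕ
block o zero = []
block o (suc m) = suc o ∷ block (suc o) m

superstandard : ℕ → List ℕ → List (List ℕ)
superstandard o [] = []
superstandard o (m ∷ μ) = block o m ∷ superstandard (o + m) μ

∈-block⁻ : ∀ {o m v} → v ∈ block o m → o < v × v ≤ o + m
∈-block⁻ {o} {suc m} (here refl) = ≤-refl , ≤-trans (s≤s (m≤m+n o m)) (≤-reflexive (sym (+-suc o m)))
∈-block⁻ {o} {suc m} (there v∈) =
  let a , b = ∈-block⁻ v∈ in <⇒≤ a , ≤-trans b (≤-reflexive (sym (+-suc o m)))

length-block : ∀ o m → length (block o m) ≡ m
length-block o zero = refl
length-block o (suc m) = cong suc (length-block (suc o) m)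

pos-block : ∀ {o m v} → o < v → v ≤ o + m → pos v (block o m) + suc o ≡ v
pos-block {o} {zero} o<v v≤ = ⊥-elim (<⇒≱ o<v (≤-trans v≤ (≤-reflexive (+-identityʳ o))))
pos-block {o} {suc m} {v} o<v v≤ with suc o ≟ v
... | yes refl rewrite ≡ᵇ-true {suc o} refl = refl
... | no ne rewrite ≡ᵇ-false ne =
  trans (sym (+-suc _ (suc o))) (pos-block (≤∧≢⇒< o<v ne) (≤-trans v≤ (≤-reflexive (+-suc o m))))

linked-block : ∀ o m → Linked _<_ (block o m)
linked-block o zero = []
linked-block o (suc zero) = [-]
linked-block o (suc (suc m)) = ≤-refl ∷ linked-block (suc o) (suc m)

block-++ : ∀ o m k → block o m ++ block (o + m) k ≡ block o (m + k)
block-++ o zero k = cong (λ x → block x k) (+-identityʳ o)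
block-++ o (suc m) k = cong (suc o ∷_) (trans (cong (λ x → block (suc o) m ++ block x k) (+-suc o m))
  (block-++ (suc o) m k))

block-applyUpTo : ∀ (f : ℕ → ℕ) o → (∀ i → f i ≡ suc (i + o)) → ∀ n → block o n ≡ applyUpTo f n
block-applyUpTo f o eq zero = refl
block-applyUpTo f o eq (suc n) = cong₂ _∷_ (sym (eq 0))
  (block-applyUpTo (λ i → f (suc i)) (suc o) (λ i → trans (eq (suc i)) (cong suc (sym (+-suc i o)))) n)

block-range1 : ∀ n → block 0 n ≡ range1 n
block-range1 n = trans (block-applyUpTo suc 0 (λ i → cong suc (sym (+-identityʳ i))) n)
  (sym (map-applyUpTo (λ i → i) suc n))

concat-superstandard : ∀ o μ → concat (superstandard o μ) ≡ block o (sum μ)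
concat-superstandard o [] = refl
concat-superstandard o (m ∷ μ) =
  trans (cong (block o m ++_) (concat-superstandard (o + m) μ)) (block-++ o m (sum μ))

superstandard-SYT : ∀ μ → SYT μ (superstandard 0 μ)
superstandard-SYT μ = shape 0 μ , ↭-reflexive (trans (concat-superstandard 0 μ) (block-range1 (sum μ)))
  , rows 0 μ , columns 0 μ
  where
  shape : ∀ o μ → map length (superstandard o μ) ≡ μ
  shape o [] = refl
  shape o (m ∷ μ) = cong₂ _∷_ (length-block o m) (shape (o + m) μ)
  rows : ∀ o μ → All (Linked _<_) (superstandard o μ)
  rows o [] = []
  rows o (m ∷ μ) = linked-block o m ∷ rows (o + m) μ
  at-∈ : ∀ {xs k x} → At {ℕ} xs k x → x ∈ xs
  at-∈ (pre , suf , refl , _) = ∈-++⁺ʳ pre (here refl)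
  columns : ∀ o μ → Linked ColUp (superstandard o μ)
  columns o [] = []
  columns o (m ∷ []) = [-]
  columns o (m ∷ k ∷ μ) = (λ _ x y y∈ x∈ →
      ≤-<-trans (proj₂ (∈-block⁻ (at-∈ x∈))) (proj₁ (∈-block⁻ (at-∈ y∈)))) ∷ columns (o + m) (k ∷ μ)

rw-∷ : ∀ r t → rw (r ∷ t) ≡ rw t ++ r
rw-∷ r t = trans (cong concat (unfold-reverse r t))
  (trans (sym (concat-++ (reverse t) (r ∷ []))) (cong (rw t ++_) (++-identityʳ r)))

∈-rw⁺ : ∀ {v} t → v ∈ concat t → v ∈ rw t
∈-rw⁺ t = ∈-resp-↭ (↭-sym (concat-↭ (↭-reverse t)))

∈-rw⁻ : ∀ {v} t → v ∈ rw t → v ∈ concat t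
∈-rw⁻ t = ∈-resp-↭ (concat-↭ (↭-reverse t))

pos-rw-upper : ∀ {v} r t → v ∈ concat t → pos v (rw (r ∷ t)) ≡ pos v (rw t)
pos-rw-upper {v} r t v∈ = trans (cong (pos v) (rw-∷ r t)) (pos-++ˡ r (∈-rw⁺ t v∈))

pos-rw-upper< : ∀ {v} r t → v ∈ concat t → pos v (rw (r ∷ t)) < length (rw t)
pos-rw-upper< r t v∈ = subst (_< length (rw t)) (sym (pos-rw-upper r t v∈)) (nth-< (nth-pos (∈-rw⁺ t v∈)))

∈-superstandard⁺ : ∀ {o v} μ → o < v → v ≤ o + sum μ → v ∈ concat (superstandard o μ)
∈-superstandard⁺ {o} {v} μ o<v v≤ = subst (v ∈_) (sym (concat-superstandard o μ))
  (go (sum μ) o<v v≤)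
  where
  go : ∀ {o v} m → o < v → v ≤ o + m → v ∈ block o m
  go {o} zero o<v v≤ = ⊥-elim (<⇒≱ o<v (≤-trans v≤ (≤-reflexive (+-identityʳ o))))
  go {o} {v} (suc m) o<v v≤ with suc o ≟ v
  ... | yes refl = here refl
  ... | no ne = there (go m (≤∧≢⇒< o<v ne) (≤-trans v≤ (≤-reflexive (+-suc o m))))

-- A new bottom row is appended to the reading word: the positions of the upper values are
-- unchanged, and every upper value precedes every bottom one.
superstandard-good : ∀ o μ → IsPartition μ → Good None μ o (λ v → pos v (rw (superstandard o μ)))
superstandard-good o [] pμ = record
  { asc = λ { zero v lo hi → ⊥-elim (<-asym lo (≤-trans hi (≤-reflexive (+-identityʳ o))))
            ; (suc i) v lo hi → ⊥-elim (<-asym lo (≤-trans hi (≤-reflexive (+-identityʳ o)))) }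
  ; yam = λ _ _ _ → record { asc-a = λ _ () ; asc-b = λ _ () ; b<a = λ _ () ; no-jam = λ _ () } }
superstandard-good o (m ∷ μ) pμ = record { asc = asc ; yam = yam }
  where
  t = superstandard (o + m) μ
  N = length (rw t)
  p : ℕ → ℕ
  p v = pos v (rw (block o m ∷ t))
  upper : Good None μ (o + m) p
  upper = good-cong (partition-tail pμ)
    (λ v lo hi → sym (pos-rw-upper (block o m) t (∈-superstandard⁺ μ lo hi)))
    (superstandard-good (o + m) μ (partition-tail pμ))
  bottom : ∀ {v} → o < v → v ≤ o + m → p v ≡ N + pos v (block o m)
  bottom {v} lo hi = trans (cong (pos v) (rw-∷ (block o m) t)) (pos-++ʳ (rw t) (block o m) λ v∈ →
    <⇒≱ (proj₁ (∈-block⁻ (subst (v ∈_) (concat-superstandard (o + m) μ) (∈-rw⁻ t v∈)))) hi)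
  bottom-asc : ∀ {v} → o < v → v < o + m → p v < p (suc v)
  bottom-asc {v} lo hi = subst₂ _<_ (sym (bottom lo (<⇒≤ hi))) (sym (bottom (<⇒≤ (s≤s lo)) hi))
    (+-monoʳ-< N (+-cancelʳ-< (suc o) _ _
      (≤-reflexive (trans (cong suc (pos-block lo (<⇒≤ hi))) (sym (pos-block (<⇒≤ (s≤s lo)) hi))))))
  asc : ∀ i v → off (m ∷ μ) o i < v → v < off (m ∷ μ) o i + part (m ∷ μ) (suc i) → p v < p (suc v)
  asc zero v = bottom-asc
  asc (suc i) = Good.asc upper i
  yam : ∀ i l → l + part (m ∷ μ) (2 + i) ≡ off (m ∷ μ) o i + part (m ∷ μ) (suc i) →
    Yamanouchi None (part (m ∷ μ) (2 + i)) (λ j → p (j + suc l)) (λ j → p (j + (part (m ∷ μ) (2 + i) + suc l)))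
  yam (suc i) = Good.yam upper i
  yam zero l eq = record
    { asc-a = λ j lt → bottom-asc (a> j) (a≤ (suc j) lt)
    ; asc-b = λ j lt → Good.asc upper 0 _ (b> j) (b≤ (suc j) lt)
    ; b<a = λ j lt → <-≤-trans
        (pos-rw-upper< (block o m) t (∈-superstandard⁺ μ (b> j) (≤-trans (b≤ j lt) (block-≤ μ (o + m) 0))))
        (≤-trans (m≤m+n N _) (≤-reflexive (sym (bottom (a> j) (a≤ j lt)))))
    ; no-jam = λ _ _ () }
    where
    k = part μ 1
    o≤l : o ≤ l
    o≤l = +-cancelʳ-≤ k o l (≤-trans (+-monoʳ-≤ o (part-antitone pμ 0)) (≤-reflexive (sym eq)))
    a> : ∀ j → o < j + suc l
    a> j = ≤-<-trans o≤l (m≤n+m (suc l) j)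
    a≤ : ∀ j → j < k → j + suc l ≤ o + m
    a≤ j lt = ≤-trans (≤-reflexive (+-suc j l)) (≤-trans (+-monoˡ-≤ l lt) (≤-reflexive (trans (+-comm k l) eq)))
    lb≡ : k + suc l ≡ suc (o + m)
    lb≡ = trans (+-suc k l) (cong suc (trans (+-comm k l) eq))
    b> : ∀ j → o + m < j + (k + suc l)
    b> j = ≤-trans (≤-reflexive (sym lb≡)) (m≤n+m _ j)
    b≤ : ∀ j → j < k → j + (k + suc l) ≤ o + m + k
    b≤ j lt = ≤-trans (≤-reflexive (trans (cong (j +_) lb≡) (+-suc j (o + m))))
      (≤-trans (+-monoˡ-≤ (o + m) lt) (≤-reflexive (+-comm k (o + m))))

-- Uniqueness of the tableau satisfying the condition

nth-++⁻ : ∀ {A : Set} {v k} (xs : List A) {ys} → Nth v (xs ++ ys) k →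
  (Nth v xs k) ⊎ (∃ λ j → k ≡ length xs + j × Nth v ys j)
nth-++⁻ [] i = inj₂ (_ , refl , i)
nth-++⁻ (x ∷ xs) here = inj₁ here
nth-++⁻ (x ∷ xs) (there i) with nth-++⁻ xs i
... | inj₁ j = inj₁ (there j)
... | inj₂ (j , eq , i') = inj₂ (j , cong suc eq , i')

linked-tail : ∀ {A : Set} {_~_ : A → A → Set} {x xs} → Linked _~_ (x ∷ xs) → Linked _~_ xs
linked-tail [-] = []
linked-tail (_ ∷ l) = l

-- Descend the column of `y`; weakly decreasing row lengths guarantee a cell below at each stage.
bottom-smaller : ∀ r t → Linked ColUp (r ∷ t) → Linked (λ a b → b ≤ a) (map length (r ∷ t)) →
  ∀ {y} → y ∈ concat t → ∃ λ x → x ∈ r × x < y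
bottom-smaller r (r' ∷ t) (up ∷ ups) (len ∷ lens) y∈ with ∈-++⁻ r' y∈
... | inj₁ y∈r' with ∈-nth y∈r'
... | k , i with <-nth (<-≤-trans (nth-< i) len)
... | x , j = x , nth-∈ j , up (suc k) x _ (nth⇒At i) (nth⇒At j)
bottom-smaller r (r' ∷ t) (up ∷ ups) (len ∷ lens) y∈ | inj₂ y∈t with bottom-smaller r' t ups lens y∈t
... | x' , x'∈ , x'<y with bottom-smaller-head x'∈
  where
  bottom-smaller-head : ∀ {x'} → x' ∈ r' → ∃ λ x → x ∈ r × x < x'
  bottom-smaller-head x'∈ with ∈-nth x'∈
  ... | k , i with <-nth (<-≤-trans (nth-< i) len)
  ... | x , j = x , nth-∈ j , up (suc k) x _ (nth⇒At i) (nth⇒At j)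
... | x , x∈ , x<x' = x , x∈ , <-trans x<x' x'<y

sorted-block : ∀ o m r → AllPairs _<_ r → (∀ {v} → v ∈ r → o < v × v ≤ o + m) →
  (∀ {v} → o < v → v ≤ o + m → v ∈ r) → r ≡ block o m
sorted-block o zero [] _ _ _ = refl
sorted-block o zero (x ∷ r) _ f _ =
  let a , b = f (here refl) in ⊥-elim (<⇒≱ a (≤-trans b (≤-reflexive (+-identityʳ o))))
sorted-block o (suc m) [] _ _ g
  with g {suc o} ≤-refl (≤-trans (s≤s (m≤m+n o m)) (≤-reflexive (sym (+-suc o m))))
... | ()
sorted-block o (suc m) (x ∷ r) (a ∷ s) f g
  with g {suc o} ≤-refl (≤-trans (s≤s (m≤m+n o m)) (≤-reflexive (sym (+-suc o m))))
... | there o∈ = ⊥-elim (<⇒≱ (All.lookup a o∈) (proj₁ (f (here refl))))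
... | here refl = cong (suc o ∷_) (sorted-block (suc o) m r s
      (λ v∈ → All.lookup a v∈ , ≤-trans (proj₂ (f (there v∈))) (≤-reflexive (+-suc o m)))
      (λ lo hi → later lo (g (<⇒≤ lo) (≤-trans hi (≤-reflexive (sym (+-suc o m)))))))
  where
  later : ∀ {v} → suc o < v → v ∈ suc o ∷ r → v ∈ r
  later lo (here refl) = ⊥-elim (<-irrefl refl lo)
  later lo (there v∈) = v∈

unique-++ʳ : ∀ {A : Set} (xs : List A) {ys} → Unique (xs ++ ys) → Unique ys
unique-++ʳ [] u = u
unique-++ʳ (x ∷ xs) (_ ∷ u) = unique-++ʳ xs u

unique-++-disjoint : ∀ {A : Set} (xs : List A) {ys v} → Unique (xs ++ ys) → v ∈ xs → v ∉ ys
unique-++-disjoint (x ∷ xs) (a ∷ _) (here refl) v∈ys = All.lookup a (∈-++⁺ʳ xs v∈ys) refl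
unique-++-disjoint (x ∷ xs) (_ ∷ u) (there v∈) v∈ys = unique-++-disjoint xs u v∈ v∈ys

-- A value above the bottom row has a smaller one in it, so the least value `suc o` lies in the
-- bottom row. That row is read last, so the ascents of block 0 keep the whole block there. The last
-- values of later blocks precede the last value of block 0; being larger, they cannot do so within
-- an increasing row, so they lie higher, and by ascent so do their blocks. The bottom row is thus
-- block 0, and the rows above are treated alike. The shape of `t` is only required to be a
-- partition; that it is `μ` comes out.
superstandard-unique : ∀ μ o t → All (1 ≤_) (map length t) → Linked (λ a b → b ≤ a) (map length t) →
  All (Linked _<_) t → Linked ColUp t → IsPartition μ → Unique (concat t) →
  (∀ {v} → v ∈ concat t → o < v × v ≤ o + sum μ) → (∀ {v} → o < v → v ≤ o + sum μ → v ∈ concat t) →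
  Good None μ o (λ v → pos v (rw t)) → t ≡ superstandard o μ
superstandard-unique [] o [] _ _ _ _ _ _ _ _ _ = refl
superstandard-unique [] o ((x ∷ r) ∷ t) _ _ _ _ _ _ f _ _ =
  let a , b = f (here refl) in ⊥-elim (<⇒≱ a (≤-trans b (≤-reflexive (+-identityʳ o))))
superstandard-unique [] o ([] ∷ t) (() ∷ _)
superstandard-unique (m ∷ μ) o [] _ _ _ _ (1≤m ∷ _ , _) _ _ g _
  with g {suc o} ≤-refl (≤-trans (≤-reflexive (+-comm 1 o)) (+-monoʳ-≤ o (≤-trans 1≤m (m≤m+n m _))))
... | ()
superstandard-unique (m ∷ μ) o (r ∷ t) (_ ∷ len≥1) lens (row ∷ rows) ups pμ@(1≤m ∷ _ , _) u f g γ =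
  cong₂ _∷_ r≡
    (superstandard-unique μ (o + m) t len≥1 (linked-tail lens) rows (linked-tail ups) (partition-tail pμ)
      (unique-++ʳ r u)
      (λ v∈ → ≰⇒> (λ le → <⇒≱ (upper< v∈) (bottom-block (proj₁ (f (∈-++⁺ʳ r v∈))) le))
            , ≤-trans (proj₂ (f (∈-++⁺ʳ r v∈))) (≤-reflexive (sym (+-assoc o m (sum μ)))))
      (λ lo hi → upper (≤-<-trans (m≤m+n o m) lo) (≤-trans hi (≤-reflexive (+-assoc o m (sum μ))))
        (upper-block lo hi))
      (good-cong (partition-tail pμ)
        (λ v lo hi → pos-rw-upper r t (upper (≤-<-trans (m≤m+n o m) lo)
          (≤-trans hi (≤-reflexive (+-assoc o m (sum μ)))) (upper-block lo hi)))
        (good-tail γ)))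
  where
  N = length (rw t)
  p : ℕ → ℕ
  p v = pos v (rw (r ∷ t))
  increasing = Linked⇒AllPairs <-trans row
  upper< : ∀ {v} → v ∈ concat t → p v < N
  upper< = pos-rw-upper< r t
  nth-p : ∀ {v} → o < v → v ≤ o + sum (m ∷ μ) → Nth v (rw t ++ r) (p v)
  nth-p {v} lo hi = subst (λ w → Nth v w (p v)) (rw-∷ r t) (nth-pos (∈-rw⁺ (r ∷ t) (g lo hi)))
  upper : ∀ {v} → o < v → v ≤ o + sum (m ∷ μ) → p v < N → v ∈ concat t
  upper lo hi lt with nth-++⁻ (rw t) (nth-p lo hi)
  ... | inj₁ i = ∈-rw⁻ t (nth-∈ i)
  ... | inj₂ (j , eq , _) = ⊥-elim (<⇒≱ lt (≤-trans (m≤m+n N j) (≤-reflexive (sym eq))))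
  bottom : ∀ {v} → o < v → v ≤ o + sum (m ∷ μ) → N ≤ p v → ∃ λ j → p v ≡ N + j × Nth v r j
  bottom lo hi le with nth-++⁻ (rw t) (nth-p lo hi)
  ... | inj₁ i = ⊥-elim (<⇒≱ (nth-< i) le)
  ... | inj₂ x = x
  m≤sum : o + m ≤ o + sum (m ∷ μ)
  m≤sum = +-monoʳ-≤ o (m≤m+n m (sum μ))
  1+o≤o+m : suc o ≤ o + m
  1+o≤o+m = ≤-trans (≤-reflexive (+-comm 1 o)) (+-monoʳ-≤ o 1≤m)
  first : N ≤ p (suc o)
  first = ≮⇒≥ λ lt →
    let x , x∈ , x<1+o = bottom-smaller r t ups lens (upper ≤-refl (≤-trans 1+o≤o+m m≤sum) lt)
    in <⇒≱ (proj₁ (f (∈-++⁺ˡ x∈))) (≤-pred x<1+o)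
  bottom-block : ∀ {v} → o < v → v ≤ o + m → N ≤ p v
  bottom-block lo hi = ≤-trans first (asc-≤ γ 0 ≤-refl lo hi)
  last-upper : ∀ i → 1 ≤ part (m ∷ μ) (2 + i) →
    p (off (m ∷ μ) o (suc i) + part (m ∷ μ) (2 + i)) < N
  -- Were the last value of block 1 in the bottom row, it would stand left of the smaller value o +
  -- m, against the increase of the row.
  last-upper zero 1≤k = ≰⇒> λ le →
    let b = o + m + part μ 1
        b≤ = block-≤ (m ∷ μ) o 1
        o+m<b = m<m+n (o + m) 1≤k
        j , eq , jth = bottom (<-trans 1+o≤o+m o+m<b) b≤ le
        j' , eq' , jth' = bottom 1+o≤o+m m≤sum (bottom-block 1+o≤o+m ≤-refl)
        j<j' = +-cancelˡ-< N j j' (subst₂ _<_ eq eq' (last-precedes pμ γ 0 1≤k))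
    in <-asym o+m<b (nth-AllPairs increasing jth jth' j<j')
  last-upper (suc i) 1≤k = <-trans (last-precedes pμ γ (suc i) 1≤k)
    (last-upper i (≤-trans 1≤k (part-antitone pμ (suc i))))
  upper-block : ∀ {v} → o + m < v → v ≤ o + m + sum μ → p v < N
  upper-block {v} lo hi with locate μ (o + m) v lo hi
  ... | i , off< , ≤off = ≤-<-trans (asc-≤ γ (suc i) off< ≤off ≤-refl)
    (last-upper i (+-cancelˡ-≤ (off μ (o + m) i) 1 _
      (≤-trans (≤-reflexive (+-comm _ 1)) (≤-trans off< ≤off))))
  r≡ : r ≡ block o m
  r≡ = sorted-block o m r increasing
    (λ {v} v∈ → proj₁ (f (∈-++⁺ˡ v∈)) , ≮⇒≥ (λ lt →
      let hi = proj₂ (f (∈-++⁺ˡ v∈)) in unique-++-disjoint r u v∈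
        (upper (<-trans 1+o≤o+m lt) hi (upper-block lt (≤-trans hi (≤-reflexive (sym (+-assoc o m (sum μ)))))))))
    (λ lo hi → let _ , _ , jth = bottom lo (≤-trans hi m≤sum) (bottom-block lo hi) in nth-∈ jth)

SYT-superstandard : ∀ {μ κ T} → IsPartition κ → IsPartition μ → sum μ ≡ sum κ → SYT κ T →
  Good None μ 0 (λ v → pos v (rw T)) → T ≡ superstandard 0 μ
SYT-superstandard {μ} {κ} {T} (κ≥1 , κ-lens) pμ eq (refl , perm , rows , ups) =
  superstandard-unique μ 0 T κ≥1 κ-lens rows ups pμ (Perm.unique perm)
    (λ v∈ → let a , b = Perm.bounds perm v∈ in a , ≤-trans b (≤-reflexive (sym eq)))
    (λ lo hi → Perm.member perm lo (≤-trans hi (≤-reflexive eq)))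

-- Standardized Yamanouchi words

-- The accumulating function local to st, which has no name outside its definition, is
-- recovered here by unification.
mutual
  stFrom : List ℕ → List ℕ → List ℕ → List ℕ
  stFrom = _

  st-∷ : ∀ a rest → st (a ∷ rest) ≡ suc (cntLt a (a ∷ rest) + 0) ∷ stFrom (a ∷ rest) (a ∷ []) rest
  st-∷ a rest with [ a ] ++ rest | [ a ]
  ... | w | pre = refl

cnt-here : ∀ a xs → cnt a (a ∷ xs) ≡ suc (cnt a xs)
cnt-here a xs rewrite ≡ᵇ-true {a} refl = refl

cnt-skip : ∀ {a x} xs → x ≢ a → cnt a (x ∷ xs) ≡ cnt a xs
cnt-skip xs ne rewrite ≡ᵇ-false ne = refl

cnt-++ : ∀ a xs ys → cnt a (xs ++ ys) ≡ cnt a xs + cnt a ys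
cnt-++ a [] ys = refl
cnt-++ a (x ∷ xs) ys with x ≡ᵇ a
... | true = cong suc (cnt-++ a xs ys)
... | false = cnt-++ a xs ys

cnt-middle : ∀ a pre suf → cnt a (pre ++ a ∷ suf) ≡ cnt a pre + suc (cnt a suf)
cnt-middle a pre suf = trans (cnt-++ a pre (a ∷ suf)) (cong (cnt a pre +_) (cnt-here a suf))

cnt-∈ : ∀ {v xs} → v ∈ xs → 1 ≤ cnt v xs
cnt-∈ {v} {x ∷ xs} (here refl) rewrite ≡ᵇ-true {x} refl = s≤s z≤n
cnt-∈ {v} {x ∷ xs} (there v∈) with x ≡ᵇ v
... | true = s≤s z≤n
... | false = cnt-∈ v∈

cnt-∉ : ∀ {v xs} → v ∉ xs → cnt v xs ≡ 0
cnt-∉ {v} {[]} _ = refl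
cnt-∉ {v} {x ∷ xs} v∉ = trans (cnt-skip xs λ e → v∉ (here (sym e))) (cnt-∉ λ i → v∉ (there i))

cnt-unique : ∀ {v xs} → Unique xs → v ∈ xs → cnt v xs ≡ 1
cnt-unique {v} {x ∷ xs} (a ∷ _) (here refl) =
  trans (cnt-here v xs) (cong suc (cnt-∉ λ i → All.lookup a i refl))
cnt-unique {v} {x ∷ xs} (a ∷ u) (there i) = trans (cnt-skip xs λ e → All.lookup a i e) (cnt-unique u i)

cntLt-suc : ∀ a xs → cntLt (suc a) xs ≡ cntLt a xs + cnt a xs
cntLt-suc a [] = refl
cntLt-suc a (x ∷ xs) with <-cmp x a
... | tri< x<a _ _ rewrite <ᵇ-true x<a | <ᵇ-true (m<n⇒m<1+n x<a) | ≡ᵇ-false (<⇒≢ x<a) = cong suc (cntLt-suc a xs)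
... | tri≈ _ refl _ rewrite <ᵇ-false {x} {x} ≤-refl | <ᵇ-true (n<1+n x) | ≡ᵇ-true {x} refl =
  trans (cong suc (cntLt-suc x xs)) (sym (+-suc (cntLt x xs) (cnt x xs)))
... | tri> _ _ a<x rewrite <ᵇ-false (<⇒≤ a<x) | <ᵇ-false a<x | ≡ᵇ-false (>⇒≢ a<x) = cntLt-suc a xs

cntLt-1 : ∀ {xs} → All (1 ≤_) xs → cntLt 1 xs ≡ 0
cntLt-1 [] = refl
cntLt-1 (s≤s _ ∷ ps) = cntLt-1 ps

cntLt-all : ∀ {a xs} → All (_< a) xs → cntLt a xs ≡ length xs
cntLt-all [] = refl
cntLt-all (p ∷ ps) rewrite <ᵇ-true p = cong suc (cntLt-all ps)

HasWeight : List ℕ → List ℕ → Set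
HasWeight μ w = All (1 ≤_) w × (∀ i → 1 ≤ i → cnt i w ≡ part μ i)

cntLt-off : ∀ {μ w} → HasWeight μ w → ∀ i → cntLt (suc i) w ≡ off μ 0 i
cntLt-off (w≥1 , _) zero = cntLt-1 w≥1
cntLt-off {μ} {w} h@(_ , c) (suc i) = trans (cntLt-suc (suc i) w)
  (trans (cong₂ _+_ (cntLt-off h i) (c (suc i) (s≤s z≤n))) (sym (off-suc μ 0 i)))

-- Letters beyond the length of `μ` have multiplicity 0, so all of `w` is counted below that bound.
-- This gives the size of a weight `μ` known only through the word.
sum-weight : ∀ {μ w} → HasWeight μ w → sum μ ≡ length w
sum-weight {μ} {w} h@(w≥1 , c) = trans (sym (off-length μ 0)) (trans (sym (cntLt-off h (length μ)))
  (cntLt-all (All.tabulate λ {x} x∈ → small x (All.lookup w≥1 x∈) (cnt-∈ x∈))))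
  where
  small : ∀ x → 1 ≤ x → 1 ≤ cnt x w → x < suc (length μ)
  small (suc x) _ 1≤c = s≤s (≰⇒> λ le →
    <⇒≱ 1≤c (≤-reflexive (trans (c (suc x) (s≤s z≤n)) (part-≥length μ x le))))

stFrom-nth : ∀ w p₀ pre {a suf} →
  Nth (suc (cntLt a w + cnt a (p₀ ++ pre))) (stFrom w p₀ (pre ++ a ∷ suf)) (length pre)
stFrom-nth w p₀ [] rewrite ++-identityʳ p₀ = here
stFrom-nth w p₀ (b ∷ pre) {a} {suf} = there (subst
  (λ xs → Nth (suc (cntLt a w + cnt a xs)) (stFrom w (p₀ ∷ʳ b) (pre ++ a ∷ suf)) (length pre))
  (++-assoc p₀ (b ∷ []) pre) (stFrom-nth w (p₀ ∷ʳ b) pre))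

st-nth : ∀ {μ w} → HasWeight μ w → ∀ i pre suf → w ≡ pre ++ suc i ∷ suf →
  Nth (suc (off μ 0 i + cnt (suc i) pre)) (st w) (length pre)
st-nth h i pre suf refl = subst (λ x → Nth (suc (x + cnt (suc i) pre)) _ (length pre))
  (cntLt-off h i) (stFrom-nth _ [] pre)

occurrence : ∀ {a c} w → c < cnt a w →
  Σ (List ℕ) λ pre → Σ (List ℕ) λ suf → (w ≡ pre ++ a ∷ suf) × (cnt a pre ≡ c)
occurrence {a} {c} (x ∷ w) lt with x ≟ a
occurrence {a} {zero} (x ∷ w) lt | yes refl = [] , w , refl , refl
occurrence {a} {suc c} (x ∷ w) lt | yes refl
  with occurrence {x} {c} w (≤-pred (≤-trans lt (≤-reflexive (cnt-here x w))))
... | pre , suf , refl , eq = x ∷ pre , suf , refl , trans (cnt-here x pre) (cong suc eq)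
occurrence {a} {c} (x ∷ w) lt | no ne
  with occurrence {a} {c} w (≤-trans lt (≤-reflexive (cnt-skip w ne)))
... | pre , suf , refl , eq = x ∷ pre , suf , refl , trans (cnt-skip pre ne) eq

split-compare : ∀ {A : Set} (pre pre' : List A) {s s'} → length pre ≤ length pre' →
  pre ++ s ≡ pre' ++ s' → Σ (List A) λ mid → pre' ≡ pre ++ mid × s ≡ mid ++ s'
split-compare [] pre' _ eq = pre' , refl , eq
split-compare (x ∷ pre) (y ∷ pre') (s≤s le) eq with split-compare pre pre' le (∷-injectiveʳ eq)
... | mid , refl , eq' = mid , cong (_∷ pre ++ mid) (sym (∷-injectiveˡ eq)) , eq'

m≤n⇒∃ : ∀ {m n} → m ≤ n → ∃ λ c → n ≡ m + c
m≤n⇒∃ {m} {n} le = n ∸ m , sym (m+[n∸m]≡n le)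

-- In Good.yam, e counts the values of block i that are compared with no value of block i + 1.
module Coordinates {μ : List ℕ} (pμ : IsPartition μ) {i l : ℕ}
    (eq : l + part μ (2 + i) ≡ off μ 0 i + part μ (suc i)) where

  k = part μ (2 + i)
  e = l ∸ off μ 0 i

  l≡ : l ≡ off μ 0 i + e
  l≡ = sym (m+[n∸m]≡n (+-cancelʳ-≤ k (off μ 0 i) l
    (≤-trans (+-monoʳ-≤ (off μ 0 i) (part-antitone pμ i)) (≤-reflexive (sym eq)))))

  e+k : e + k ≡ part μ (suc i)
  e+k = +-cancelˡ-≡ (off μ 0 i) _ _
    (trans (sym (+-assoc (off μ 0 i) e k)) (trans (cong (_+ k) (sym l≡)) eq))

  a-value : ∀ j → j + suc l ≡ suc (off μ 0 i + (e + j))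
  a-value j = trans (+-suc j l) (cong suc (trans (+-comm j l)
    (trans (cong (_+ j) l≡) (+-assoc (off μ 0 i) e j))))

  b-value : ∀ j → j + (k + suc l) ≡ suc (off μ 0 (suc i) + j)
  b-value j = trans (cong (j +_) (+-suc k l)) (trans (+-suc j (k + l)) (cong suc (trans (+-comm j (k + l))
    (cong (_+ j) (trans (+-comm k l) (trans eq (sym (off-suc μ 0 i))))))))

  e+j< : ∀ {j} → j < k → e + j < part μ (suc i)
  e+j< {j} j<k = subst (e + j <_) e+k (+-monoʳ-< e j<k)

module FromSYam {δ : List Cell} {μ w : List ℕ} (pμ : IsPartition μ) (yd : YamD δ μ w) (perm : IsPerm (length δ) (st w)) where

  h : HasWeight μ w
  h = proj₁ (proj₁ yd) , proj₁ (proj₂ (proj₁ yd))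

  p : ℕ → ℕ
  p v = pos v (st w)

  -- Occurrence number `c`, counted from 0 on the left, of the letter `suc i`. Standardization
  -- numbers from the left while the Yamanouchi and jam conditions count from the right; `after`
  -- converts between them.
  record Occurs (i c : ℕ) : Set where
    field
      pre suf : List ℕ
      split   : w ≡ pre ++ suc i ∷ suf
      before  : cnt (suc i) pre ≡ c
      after   : c + suc (cnt (suc i) suf) ≡ part μ (suc i)
      at-p    : p (suc (off μ 0 i + c)) ≡ length pre

  occurs : ∀ i c → c < part μ (suc i) → Occurs i c
  occurs i c lt with occurrence {suc i} {c} w (≤-trans lt (≤-reflexive (sym (proj₂ h (suc i) (s≤s z≤n)))))
  ... | pre , suf , eq , refl = record
    { pre = pre ; suf = suf ; split = eq ; before = refl
    ; after = trans (sym (cnt-middle (suc i) pre suf))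
        (trans (cong (cnt (suc i)) (sym eq)) (proj₂ h (suc i) (s≤s z≤n)))
    ; at-p = pos-nth (Perm.unique perm) (st-nth h i pre suf eq) }

  occurs-< : ∀ i c → suc c < part μ (suc i) →
    p (suc (off μ 0 i + c)) < p (suc (off μ 0 i + suc c))
  occurs-< i c lt = subst₂ _<_ (sym (at-p o)) (sym (at-p o')) (≰⇒> λ le →
      let mid , eq , _ = split-compare (pre o') (pre o) le (trans (sym (split o')) (split o))
      in <⇒≱ (n<1+n c) (subst₂ _≤_ (before o') (before o)
           (≤-trans (m≤m+n _ _) (≤-reflexive (trans (sym (cnt-++ (suc i) (pre o') mid))
             (cong (cnt (suc i)) (sym eq)))))))
    where
    open Occurs
    o = occurs i c (<⇒≤ lt)
    o' = occurs i (suc c) lt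

  asc : ∀ i v → off μ 0 i < v → v < off μ 0 i + part μ (suc i) → p v < p (suc v)
  asc i v lo hi with m≤n⇒∃ lo
  ... | c , refl = subst (λ x → p (suc (off μ 0 i + c)) < p (suc x)) (+-suc (off μ 0 i) c)
    (occurs-< i c (+-cancelˡ-< (off μ 0 i) _ _ (≤-trans (≤-reflexive (cong suc (+-suc (off μ 0 i) c))) hi)))

  good : Good (PistoledPair δ) μ 0 p
  good = record { asc = asc ; yam = yam }
    where
    yam : ∀ i l → l + part μ (2 + i) ≡ off μ 0 i + part μ (suc i) →
      Yamanouchi (PistoledPair δ) (part μ (2 + i)) (λ j → p (j + suc l)) (λ j → p (j + (part μ (2 + i) + suc l)))
    yam i l eq = record
      { asc-a = λ j lt → subst₂ (λ x y → p x < p y) (sym (a-value j))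
          (sym (trans (a-value (suc j)) (cong (λ x → suc (off μ 0 i + x)) (+-suc e j))))
          (occurs-< i (e + j) (subst (_< part μ (suc i)) (+-suc e j) (e+j< lt)))
      ; asc-b = λ j lt → subst₂ (λ x y → p x < p y) (sym (b-value j)) (sym (b-value (suc j)))
          (occurs-< (suc i) j lt)
      ; b<a = λ j lt → subst₂ (λ x y → p x < p y) (sym (b-value j)) (sym (a-value j)) (b-first j lt)
      ; no-jam = not-pistoled }
      where
      open Coordinates {μ} pμ {i} {l} eq
      open Occurs
      b-first : ∀ j → j < k → p (suc (off μ 0 (suc i) + j)) < p (suc (off μ 0 i + (e + j)))
      b-first j lt = subst₂ _<_ (sym (at-p oᵇ)) (sym (at-p oᵃ)) (≰⇒> absurd)
        where
        oᵃ = occurs i (e + j) (e+j< lt)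
        oᵇ = occurs (suc i) j lt
        afters : cnt (suc i) (suf oᵃ) ≡ cnt (2 + i) (suf oᵇ)
        afters = suc-injective (+-cancelˡ-≡ (e + j) _ _ (trans (after oᵃ) (trans (sym e+k)
          (trans (cong (e +_) (sym (after oᵇ))) (sym (+-assoc e j _))))))
        -- Both occurrences have equally many copies of their letter after them. If the smaller
        -- letter came first, the suffix starting at the larger one would contain too many larger
        -- letters.
        absurd : ¬ length (pre oᵃ) ≤ length (pre oᵇ)
        absurd le with split-compare (pre oᵃ) (pre oᵇ) le (trans (sym (split oᵃ)) (split oᵇ))
        ... | [] , _ , eq' = 1+n≢n (sym (∷-injectiveˡ eq'))
        ... | x ∷ mid , _ , eq' = <-irrefl refl (begin-strict
          cnt (2 + i) (suf oᵇ)              <⟨ n<1+n _ ⟩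
          suc (cnt (2 + i) (suf oᵇ))        ≡⟨ cnt-here (2 + i) (suf oᵇ) ⟨
          cnt (2 + i) (2 + i ∷ suf oᵇ)      ≤⟨ proj₂ (proj₂ (proj₁ yd)) (pre oᵇ) _ (split oᵇ) (suc i) (s≤s z≤n) ⟩
          cnt (suc i) (2 + i ∷ suf oᵇ)      ≤⟨ m≤n+m _ (cnt (suc i) mid) ⟩
          cnt (suc i) mid + cnt (suc i) (2 + i ∷ suf oᵇ) ≡⟨ cnt-++ (suc i) mid _ ⟨
          cnt (suc i) (mid ++ 2 + i ∷ suf oᵇ) ≡⟨ cong (cnt (suc i)) (∷-injectiveʳ eq') ⟨
          cnt (suc i) (suf oᵃ)              ≡⟨ afters ⟩
          cnt (2 + i) (suf oᵇ)              ∎)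
          where open ≤-Reasoning
      not-pistoled : ∀ j → suc j < k → ¬ PistoledPair δ (p (j + (k + suc l))) (p (suc j + suc l))
      not-pistoled j lt r = proj₂ (proj₂ yd) (suc i , suc (cnt (suc i) (suf oᵃ)) , _ , _ , s≤s z≤n , s≤s z≤n
          , (pre oᵃ , suf oᵃ , split oᵃ , cong suc (trans (sym (at-p oᵃ)) (cong p (sym (a-value (suc j))))) , refl)
          , (pre oᵇ , suf oᵇ , split oᵇ , cong suc (trans (sym (at-p oᵇ)) (cong p (sym (b-value j)))) , cong suc (sym afters))
          , pistoled-pair r (there (here refl)) (here refl))
        where
        oᵃ = occurs i (e + suc j) (e+j< lt)
        oᵇ = occurs (suc i) j (<⇒≤ lt)
        afters : suc (cnt (suc i) (suf oᵃ)) ≡ cnt (2 + i) (suf oᵇ)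
        afters = suc-injective (+-cancelˡ-≡ (e + j) _ _ (begin
          e + j + suc (suc (cnt (suc i) (suf oᵃ)))   ≡⟨ +-suc (e + j) _ ⟩
          suc (e + j) + suc (cnt (suc i) (suf oᵃ))   ≡⟨ cong (_+ suc (cnt (suc i) (suf oᵃ))) (+-suc e j) ⟨
          e + suc j + suc (cnt (suc i) (suf oᵃ))     ≡⟨ after oᵃ ⟩
          part μ (suc i)                             ≡⟨ e+k ⟨
          e + k                                      ≡⟨ cong (e +_) (after oᵇ) ⟨
          e + (j + suc (cnt (2 + i) (suf oᵇ)))       ≡⟨ +-assoc e j _ ⟨
          e + j + suc (cnt (2 + i) (suf oᵇ))         ∎))
          where open ≡-Reasoning

-- From the condition on positions back to Yamanouchi words

cntRange : ℕ → ℕ → List ℕ → ℕ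
cntRange l zero xs = 0
cntRange l (suc k) xs = cnt l xs + cntRange (suc l) k xs

cntRange-out : ∀ {l x} k xs → x < l ⊎ l + k ≤ x → cntRange l k (x ∷ xs) ≡ cntRange l k xs
cntRange-out zero xs _ = refl
cntRange-out {l} {x} (suc k) xs (inj₁ x<l) =
  cong₂ _+_ (cnt-skip xs (<⇒≢ x<l)) (cntRange-out k xs (inj₁ (m<n⇒m<1+n x<l)))
cntRange-out {l} {x} (suc k) xs (inj₂ le) =
  cong₂ _+_ (cnt-skip xs (>⇒≢ (<-≤-trans (m<m+n l (s≤s z≤n)) le)))
    (cntRange-out k xs (inj₂ (≤-trans (≤-reflexive (sym (+-suc l k))) le)))

cntRange-in : ∀ {l x} k xs → l ≤ x → x < l + k → cntRange l k (x ∷ xs) ≡ suc (cntRange l k xs)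
cntRange-in {l} zero xs le lt = ⊥-elim (<⇒≱ lt (≤-trans (≤-reflexive (+-identityʳ l)) le))
cntRange-in {l} {x} (suc k) xs le lt with l ≟ x
... | yes refl = cong₂ _+_ (cnt-here l xs) (cntRange-out k xs (inj₁ ≤-refl))
... | no ne = trans (cong₂ _+_ (cnt-skip xs (≢-sym ne))
    (cntRange-in k xs (≤∧≢⇒< le ne) (≤-trans lt (≤-reflexive (+-suc l k)))))
    (+-suc (cnt l xs) _)

cntRange-+ : ∀ l k k' xs → cntRange l (k + k') xs ≡ cntRange l k xs + cntRange (k + l) k' xs
cntRange-+ l zero k' xs = refl
cntRange-+ l (suc k) k' xs = trans (cong (cnt l xs +_) (trans (cntRange-+ (suc l) k k' xs)
    (cong (λ x → cntRange (suc l) k xs + cntRange x k' xs) (+-suc k l))))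
  (sym (+-assoc (cnt l xs) _ _))

cntRange-≡ : ∀ {l xs c} k → (∀ j → j < k → cnt (j + l) xs ≡ c) → cntRange l k xs ≡ k * c
cntRange-≡ zero f = refl
cntRange-≡ {l} {xs} (suc k) f = cong₂ _+_ (f 0 (s≤s z≤n))
  (cntRange-≡ k (λ j lt → trans (cong (λ x → cnt x xs) (+-suc j l)) (f (suc j) (s≤s lt))))

cntRange-≤ : ∀ {l l' xs} k → (∀ j → j < k → cnt (j + l) xs ≤ cnt (j + l') xs) →
  cntRange l k xs ≤ cntRange l' k xs
cntRange-≤ zero f = z≤n
cntRange-≤ {l} {l'} {xs} (suc k) f = +-mono-≤ (f 0 (s≤s z≤n)) (cntRange-≤ k λ j lt →
  subst₂ (λ x y → cnt x xs ≤ cnt y xs) (sym (+-suc j l)) (sym (+-suc j l')) (f (suc j) (s≤s lt)))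

-- Undoes standardization: a value is replaced by the number of its block, counted from 1. The 1 for
-- the empty list is a default for values beyond all blocks.
letter : List ℕ → ℕ → ℕ → ℕ
letter [] o v = 1
letter (m ∷ μ) o v with v ≤? o + m
... | yes _ = 1
... | no _ = suc (letter μ (o + m) v)

1≤letter : ∀ μ o v → 1 ≤ letter μ o v
1≤letter [] o v = ≤-refl
1≤letter (m ∷ μ) o v with v ≤? o + m
... | yes _ = ≤-refl
... | no _ = s≤s z≤n

letter-block : ∀ μ o i {v} → InBlock μ o i v → letter μ o v ≡ suc i
letter-block [] o zero _ = refl
letter-block [] o (suc i) (lo , hi) = ⊥-elim (<⇒≱ lo (≤-trans hi (≤-reflexive (+-identityʳ o))))
letter-block (m ∷ μ) o zero {v} (lo , hi) with v ≤? o + m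
... | yes _ = refl
... | no n = ⊥-elim (n hi)
letter-block (m ∷ μ) o (suc i) {v} (lo , hi) with v ≤? o + m
... | yes y = ⊥-elim (<⇒≱ lo (≤-trans y (off-≥ μ (o + m) i)))
... | no _ = cong suc (letter-block μ (o + m) i (lo , hi))

map-split : ∀ {A B : Set} (f : A → B) xs {ys zs} → map f xs ≡ ys ++ zs →
  Σ (List A) λ xs₁ → Σ (List A) λ xs₂ → xs ≡ xs₁ ++ xs₂ × map f xs₂ ≡ zs
map-split f xs {[]} eq = [] , xs , refl , eq
map-split f (x ∷ xs) {y ∷ ys} eq with map-split f xs {ys} (∷-injectiveʳ eq)
... | xs₁ , xs₂ , refl , eq' = x ∷ xs₁ , xs₂ , refl , eq'

module ToSYam {δ : List Cell} {μ π : List ℕ} (pμ : IsPartition μ) (|μ| : sum μ ≡ length δ)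
    (perm : IsPerm (length δ) π) (γ : Good (PistoledPair δ) μ 0 (λ v → pos v π)) where

  n = length δ

  p : ℕ → ℕ
  p v = pos v π

  open Perm perm

  L : ℕ → ℕ
  L = letter μ 0

  w : List ℕ
  w = map L π

  block-≤n : ∀ i → off μ 0 i + part μ (suc i) ≤ n
  block-≤n i = ≤-trans (block-≤ μ 0 i) (≤-reflexive |μ|)

  in-range : ∀ {i c} → c < part μ (suc i) → c + suc (off μ 0 i) ∈ π
  in-range {i} {c} lt = member (≤-trans (s≤s z≤n) (m≤n+m _ c)) (≤-trans (≤-reflexive (+-suc c _))
    (≤-trans (+-monoˡ-≤ (off μ 0 i) lt) (≤-trans (≤-reflexive (+-comm _ (off μ 0 i))) (block-≤n i))))

  located : ∀ {v} → v ∈ π → ∃ λ i → InBlock μ 0 i v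
  located v∈ = let a , b = bounds v∈ in locate μ 0 _ a (≤-trans b (≤-reflexive (sym |μ|)))

  -- Counting a letter becomes a sum over the values of its block, the form in which two blocks can
  -- be compared value by value.
  cnt-map : ∀ i xs → (∀ {v} → v ∈ xs → v ∈ π) →
    cnt (suc i) (map L xs) ≡ cntRange (suc (off μ 0 i)) (part μ (suc i)) xs
  cnt-map i [] _ = sym (trans (cntRange-≡ (part μ (suc i)) λ _ _ → refl) (*-zeroʳ (part μ (suc i))))
  cnt-map i (x ∷ xs) ⊆π with located (⊆π (here refl))
  ... | i' , blk with i' ≟ i
  ... | yes refl = trans (trans (cong (λ a → cnt (suc i) (a ∷ map L xs)) (letter-block μ 0 i blk))
        (cnt-here (suc i) (map L xs)))
      (trans (cong suc (cnt-map i xs λ v∈ → ⊆π (there v∈)))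
        (sym (cntRange-in (part μ (suc i)) xs (proj₁ blk) (s≤s (proj₂ blk)))))
  ... | no ne = trans (cnt-skip (map L xs) λ e → ne (suc-injective (trans (sym (letter-block μ 0 i' blk)) e)))
      (trans (cnt-map i xs λ v∈ → ⊆π (there v∈)) (sym (cntRange-out (part μ (suc i)) xs outside)))
    where
    outside : x < suc (off μ 0 i) ⊎ suc (off μ 0 i) + part μ (suc i) ≤ x
    outside with x ≤? off μ 0 i | x ≤? off μ 0 i + part μ (suc i)
    ... | yes le | _ = inj₁ (s≤s le)
    ... | no _ | no nle = inj₂ (≰⇒> nle)
    ... | no nle | yes le = ⊥-elim (ne (suc-injective
          (trans (sym (letter-block μ 0 i' blk)) (letter-block μ 0 i (≰⇒> nle , le)))))

  weight : HasWeight μ w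
  weight = All.tabulate (λ x∈ → positive x∈) , counts
    where
    positive : ∀ {x} → x ∈ w → 1 ≤ x
    positive x∈ with ∈-map⁻ L x∈
    ... | v , _ , refl = 1≤letter μ 0 v
    counts : ∀ i → 1 ≤ i → cnt i w ≡ part μ i
    counts (suc i) _ = trans (cnt-map i π λ v∈ → v∈)
      (trans (cntRange-≡ (part μ (suc i)) λ j lt → cnt-unique unique (in-range lt)) (*-identityʳ _))

  block-< : ∀ i {u v} → off μ 0 i < u → u < v → v ≤ off μ 0 i + part μ (suc i) → p u < p v
  block-< i {u} lo lt hi = <-≤-trans (Good.asc γ i u lo (<-≤-trans lt hi)) (asc-≤ γ i (<⇒≤ (s≤s lo)) lt hi)

  before : ∀ {pre x suf} → π ≡ pre ++ x ∷ suf → p x ≡ length pre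
  before {pre} refl = pos-nth unique (nth-++ pre)

  ∈-pre : ∀ {pre x suf v} → π ≡ pre ++ x ∷ suf → v ∈ π → p v < p x → v ∈ pre
  ∈-pre {pre} {x} {suf} {v} eq v∈ lt with ∈-++⁻ pre (subst (v ∈_) eq v∈)
  ... | inj₁ v∈pre = v∈pre
  ... | inj₂ v∈suf with ∈-nth v∈suf
  ... | j , nth = ⊥-elim (<⇒≱ lt (≤-trans (≤-reflexive (before {pre} eq)) (≤-trans (m≤m+n _ j)
        (≤-reflexive (sym (pos-nth unique (subst (λ xs → Nth v xs _) (sym eq) (nth-++ʳ pre nth))))))))

  pre-< : ∀ {pre x suf v} → π ≡ pre ++ x ∷ suf → v ∈ pre → p v < p x
  pre-< {pre} {x} {suf} {v} eq v∈ with ∈-nth v∈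
  ... | j , nth = subst₂ _<_
    (sym (pos-nth unique (subst (λ xs → Nth v xs j) (sym eq) (nth-++ˡ (x ∷ suf) nth))))
    (sym (before {pre} eq)) (nth-< nth)

  unique-pre : ∀ {pre suf} → π ≡ pre ++ suf → Unique pre
  unique-pre {pre} refl = go pre unique
    where
    go : ∀ xs {ys} → Unique (xs ++ ys) → Unique xs
    go [] _ = []
    go (x ∷ xs) (a ∷ u) = All.tabulate (λ v∈ → All.lookup a (∈-++⁺ˡ v∈)) ∷ go xs u

  -- Let `c` be the number of smaller values in the block of `x` and `r` the number of larger ones.
  -- Positions ascend inside the block, so the prefix before `x` contains exactly those `c` values.
  value : ∀ {pre x suf} → π ≡ pre ++ x ∷ suf → suc (cntLt (L x) w + cnt (L x) (map L pre)) ≡ x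
  value {pre} {x} {suf} eq with located (subst (x ∈_) (sym eq) (∈-++⁺ʳ pre (here refl)))
  ... | i , blk with m≤n⇒∃ (proj₁ blk)
  ... | c , refl with m≤n⇒∃ (+-cancelˡ-≤ (off μ 0 i) _ _ (≤-trans (≤-reflexive (+-suc _ c)) (proj₂ blk)))
  ... | r , part≡ rewrite letter-block μ 0 i blk | cntLt-off weight i
      | cnt-map i pre (λ {v} v∈ → subst (v ∈_) (sym eq) (∈-++⁺ˡ v∈)) =
    cong (λ k → suc (off μ 0 i + k)) count
    where
    l = suc (off μ 0 i)
    l+c : c + l ≡ suc (off μ 0 i + c)
    l+c = trans (+-suc c _) (cong suc (+-comm c _))
    c<part : c < part μ (suc i)
    c<part = ≤-trans (m≤m+n (suc c) r) (≤-reflexive (sym part≡))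
    one : ∀ j → j < c → cnt (j + l) pre ≡ 1
    one j lt = cnt-unique (unique-pre eq) (∈-pre eq (in-range (<-trans lt c<part))
      (block-< i (m≤n+m l j) (subst (j + l <_) l+c (+-monoˡ-< l lt)) (proj₂ blk)))
    none : ∀ j → j < suc r → cnt (j + (c + l)) pre ≡ 0
    none j lt = cnt-∉ λ v∈ → <⇒≱ (pre-< eq v∈) (asc-≤ γ i (proj₁ blk)
      (≤-trans (≤-reflexive (sym l+c)) (m≤n+m (c + l) j))
      (≤-pred (subst₂ _<_ (+-assoc j c l) (trans (+-suc (suc r + c) (off μ 0 i)) (cong suc (trans (+-comm (suc r + c) (off μ 0 i)) (cong (off μ 0 i +_) total))))
        (+-monoˡ-< l (+-monoˡ-< c lt)))))
      where
      total : suc r + c ≡ part μ (suc i)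
      total = trans (cong suc (+-comm r c)) (sym part≡)
    count : cntRange l (part μ (suc i)) pre ≡ c
    count = begin
      cntRange l (part μ (suc i)) pre                       ≡⟨ cong (λ k → cntRange l k pre) (trans part≡ (sym (+-suc c r))) ⟩
      cntRange l (c + suc r) pre                            ≡⟨ cntRange-+ l c (suc r) pre ⟩
      cntRange l c pre + cntRange (c + l) (suc r) pre       ≡⟨ cong₂ _+_ (cntRange-≡ c one) (cntRange-≡ (suc r) none) ⟩
      c * 1 + suc r * 0                                     ≡⟨ cong₂ _+_ (*-identityʳ c) (*-zeroʳ (suc r)) ⟩
      c + 0                                                 ≡⟨ +-identityʳ c ⟩
      c                                                     ∎
      where open ≡-Reasoning

  st-w : st w ≡ π
  st-w = go [] π refl
    where
    go : ∀ pre rest → π ≡ pre ++ rest → stFrom w (map L pre) (map L rest) ≡ rest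
    go pre [] eq = refl
    go pre (x ∷ rest) eq = cong₂ _∷_ (value {pre} eq)
      (trans (cong (λ xs → stFrom w xs (map L rest)) (sym (map-++ L pre (x ∷ []))))
        (go (pre ∷ʳ x) rest (trans eq (sym (++-assoc pre (x ∷ []) rest)))))

  module Blocks (i : ℕ) where

    l = (off μ 0 i + part μ (suc i)) ∸ part μ (2 + i)

    l+k : l + part μ (2 + i) ≡ off μ 0 i + part μ (suc i)
    l+k = m∸n+n≡m (≤-trans (part-antitone pμ i) (m≤n+m _ (off μ 0 i)))

    open Coordinates {μ} pμ {i} {l} l+k public

    rows = Good.yam γ i l l+k

    lb≡ : k + suc l ≡ suc (off μ 0 (suc i))
    lb≡ = trans (b-value 0) (cong suc (+-identityʳ _))

    e+l≡ : e + suc (off μ 0 i) ≡ suc l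
    e+l≡ = trans (+-suc e _) (cong suc (trans (+-comm e _) (sym l≡)))

    a∈ : ∀ {j} → j < k → j + suc l ∈ π
    a∈ {j} lt = subst (_∈ π) (trans (+-suc (e + j) _) (trans (cong suc (+-comm (e + j) _)) (sym (a-value j))))
      (in-range (e+j< lt))

  -- Termwise: if the j-th value of block i + 1 is in the suffix, so is the later value compared with it.
  suffix : ∀ pre suf → w ≡ pre ++ suf → ∀ i → 1 ≤ i → cnt (suc i) suf ≤ cnt i suf
  suffix pre suf eq (suc i) _ with map-split L π {pre} {suf} eq
  ... | pre' , suf' , eq' , refl = begin
    cnt (2 + i) (map L suf')                                      ≡⟨ cnt-map (suc i) suf' ⊆π ⟩
    cntRange (suc (off μ 0 (suc i))) k suf'                       ≡⟨ cong (λ x → cntRange x k suf') lb≡ ⟨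
    cntRange (k + suc l) k suf'                                   ≤⟨ cntRange-≤ k termwise ⟩
    cntRange (suc l) k suf'                                       ≡⟨ cong (λ x → cntRange x k suf') e+l≡ ⟨
    cntRange (e + suc (off μ 0 i)) k suf'                         ≤⟨ m≤n+m _ _ ⟩
    cntRange (suc (off μ 0 i)) e suf' + cntRange (e + suc (off μ 0 i)) k suf' ≡⟨ cntRange-+ _ e k suf' ⟨
    cntRange (suc (off μ 0 i)) (e + k) suf'                       ≡⟨ cong (λ x → cntRange (suc (off μ 0 i)) x suf') e+k ⟩
    cntRange (suc (off μ 0 i)) (part μ (suc i)) suf'              ≡⟨ cnt-map i suf' ⊆π ⟨
    cnt (suc i) (map L suf')                                      ∎
    where
    open ≤-Reasoning
    open Blocks i
    ⊆π : ∀ {v} → v ∈ suf' → v ∈ π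
    ⊆π {v} v∈ = subst (v ∈_) (sym eq') (∈-++⁺ʳ pre' v∈)
    later : ∀ {u v} → u ∈ suf' → v ∈ π → p u < p v → v ∈ suf'
    later {u} {v} u∈ v∈ lt with ∈-++⁻ pre' (subst (v ∈_) eq' v∈)
    ... | inj₂ v∈suf = v∈suf
    ... | inj₁ v∈pre with ∈-nth u∈ | ∈-nth v∈pre
    ... | j , nth | j' , nth' = ⊥-elim (<⇒≱ lt (subst₂ _≤_
          (sym (pos-nth unique (subst (λ xs → Nth v xs j') (sym eq') (nth-++ˡ suf' nth'))))
          (sym (pos-nth unique (subst (λ xs → Nth u xs _) (sym eq') (nth-++ʳ pre' nth))))
          (≤-trans (<⇒≤ (nth-< nth')) (m≤m+n _ j))))
    termwise : ∀ j → j < k → cnt (j + (k + suc l)) suf' ≤ cnt (j + suc l) suf'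
    termwise j lt with j + (k + suc l) ∈? suf'
    ... | no b∉ = ≤-trans (≤-reflexive (cnt-∉ b∉)) z≤n
    ... | yes b∈suf = subst (_≤ cnt (j + suc l) suf')
          (sym (cnt-unique (unique-++ʳ pre' (subst Unique eq' unique)) b∈suf))
          (cnt-∈ (later b∈suf (a∈ lt) (Yamanouchi.b<a rows j lt)))

  occurrence-pos : ∀ i pre {suf} → w ≡ pre ++ suc i ∷ suf →
    p (suc (off μ 0 i + cnt (suc i) pre)) ≡ length pre
  occurrence-pos i pre {suf} eq =
    pos-nth unique (subst (λ xs → Nth _ xs (length pre)) st-w (st-nth weight i pre suf eq))

  occurrence-cnt : ∀ i pre {suf} → w ≡ pre ++ suc i ∷ suf →
    cnt (suc i) pre + suc (cnt (suc i) suf) ≡ part μ (suc i)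
  occurrence-cnt i pre {suf} eq = trans (sym (cnt-middle (suc i) pre suf))
    (trans (cong (cnt (suc i)) (sym eq)) (proj₂ weight (suc i) (s≤s z≤n)))

  -- Indices counted from the last occurrence are converted to indices from the left: a jam then
  -- concerns exactly entry `j` of the later block's row and entry `suc j` of the earlier one's.
  not-jammed : ¬ Jams δ w
  not-jammed (suc i , _ , _ , _ , _ , _ , (preᵃ , sufᵃ , eqᵃ , refl , refl) , (preᵇ , sufᵇ , eqᵇ , refl , cᵇ) , pd) =
    Yamanouchi.no-jam rows j (≤-trans (≤-reflexive (+-comm 2 j)) (≤-trans (+-monoʳ-≤ j (s≤s (s≤s z≤n))) (≤-reflexive k≡)))
      (subst₂ (PistoledPair δ) at-b at-a (pistoled-pair pd (there (here refl)) (here refl)))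
    where
    open Blocks i
    j = cnt (2 + i) preᵇ
    k≡ : j + suc (suc (cnt (suc i) sufᵃ)) ≡ k
    k≡ = trans (cong (j +_) (sym cᵇ)) (occurrence-cnt (suc i) preᵇ eqᵇ)
    at-b : length preᵇ ≡ p (j + (k + suc l))
    at-b = trans (sym (occurrence-pos (suc i) preᵇ eqᵇ)) (cong p (sym (b-value j)))
    index-a : cnt (suc i) preᵃ ≡ e + suc j
    index-a = +-cancelʳ-≡ (suc (cnt (suc i) sufᵃ)) _ _ (begin
      cnt (suc i) preᵃ + suc (cnt (suc i) sufᵃ)     ≡⟨ occurrence-cnt i preᵃ eqᵃ ⟩
      part μ (suc i)                                ≡⟨ e+k ⟨
      e + k                                         ≡⟨ cong (e +_) k≡ ⟨
      e + (j + suc (suc (cnt (suc i) sufᵃ)))        ≡⟨ cong (e +_) (+-suc j _) ⟩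
      e + (suc j + suc (cnt (suc i) sufᵃ))          ≡⟨ +-assoc e (suc j) _ ⟨
      e + suc j + suc (cnt (suc i) sufᵃ)            ∎)
      where open ≡-Reasoning
    at-a : length preᵃ ≡ p (suc j + suc l)
    at-a = trans (sym (occurrence-pos i preᵃ eqᵃ)) (cong p (trans (cong (λ c → suc (off μ 0 i + c)) index-a)
      (sym (a-value (suc j)))))

  sYam : SYam δ μ π
  sYam = w , ((proj₁ weight , proj₂ weight , suffix) ,
    trans (length-map L π) (trans (↭-length perm) (trans (length-map suc (upTo n)) (length-upTo n))) , not-jammed) , st-w

-- Existence, uniqueness, and absence of other weights

theorem1p2 : (δ : List Cell) → Diagram δ →
    (λ' : List ℕ) → IsPartition λ' → sum λ' ≡ length δ →
    (v0 : List ℕ) → IsPerm (length δ) v0 →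
    IsDEG (length δ) (Assaf δ) (Comp (Assaf δ) (IsPerm (length δ)) (length δ) v0) →
    Iso (length δ) (Assaf δ) (Comp (Assaf δ) (IsPerm (length δ)) (length δ) v0)
    StdGraph (SYT λ') →
    (Σ (List ℕ) λ π → Comp (Assaf δ) (IsPerm (length δ)) (length δ) v0 π × SYam δ λ' π ×
    (∀ π' → Comp (Assaf δ) (IsPerm (length δ)) (length δ) v0 π' → SYam δ λ' π' → π' ≡ π))
    × (∀ μ → IsPartition μ → μ ≢ λ' →
    ∀ π → Comp (Assaf δ) (IsPerm (length δ)) (length δ) v0 π → ¬ SYam δ μ π)
theorem1p2 δ D λ' pλ |λ| v0 _ _ iso =
  (g U , into U U-SYT , ToSYam.sYam pλ |λ| (proj₁ (into U U-SYT)) U-good , unique) , other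
  where
  open Iso iso
  open FromIso D |λ| iso using (bisim)

  U : List (List ℕ)
  U = superstandard 0 λ'

  U-SYT : SYT λ' U
  U-SYT = superstandard-SYT λ'

  none-closed : IntervalClosed None
  none-closed _ _ _ ()

  U-good : Good (PistoledPair δ) λ' 0 (λ v → pos v (g U))
  U-good = good-transfer bisim none-closed (pistoledPair-closed D) |λ| (U , U-SYT , refl , refl)
    (superstandard-good 0 λ' pλ)

  -- The reversed bisimulation carries the condition to the tableau over `π`, which must then be
  -- superstandard of weight `μ`. For `μ` equal to `λ'` this yields uniqueness; in general its shape
  -- is both `μ` and `λ'`.
  preimage : ∀ {μ π} → IsPartition μ → Comp (Assaf δ) (IsPerm (length δ)) (length δ) v0 π →
    SYam δ μ π → SYT λ' (superstandard 0 μ) × g (superstandard 0 μ) ≡ π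
  preimage {μ} pμ Cπ (w , yd , refl) with surj (st w) Cπ
  ... | T , T-SYT , gT≡ = subst (SYT λ') T≡ T-SYT , trans (cong g (sym T≡)) gT≡
    where
    open FromSYam pμ yd (proj₁ Cπ)
    |μ| : sum μ ≡ length δ
    |μ| = trans (sum-weight {μ} {w} h) (proj₁ (proj₂ yd))
    T≡ : T ≡ superstandard 0 μ
    T≡ = SYT-superstandard pλ pμ (trans |μ| (sym |λ|)) T-SYT
      (good-transfer (flip-Bisim bisim) (pistoledPair-closed D) none-closed |μ|
        (T , T-SYT , refl , cong (λ π v → pos v π) (sym gT≡)) good)

  unique : ∀ π' → Comp (Assaf δ) (IsPerm (length δ)) (length δ) v0 π' → SYam δ λ' π' → π' ≡ g U
  unique π' Cπ' sy = sym (proj₂ (preimage pλ Cπ' sy))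

  other : ∀ μ → IsPartition μ → μ ≢ λ' →
    ∀ π → Comp (Assaf δ) (IsPerm (length δ)) (length δ) v0 π → ¬ SYam δ μ π
  other μ pμ μ≢λ' π Cπ sy =
    μ≢λ' (trans (sym (proj₁ (superstandard-SYT μ))) (proj₁ (proj₁ (preimage pμ Cπ sy))))
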